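{- Let $n\ge 4$. The number $|G(n,n-4)/Z_n|$ of cyclic equivalence classes of $(n-4)$-dissections (almost-triangulations) of a convex regular $n$-gon is \[ \frac{n-3}{2n}C_{n-2}+\frac{1}{2}C_{n/4-1}+\frac{1}{4}C_{n/2-1}. \]
   Context: For $n\ge 3$ and $0\le k\le n-3$, a $k$-dissection of a convex regular $n$-gon is a partition of it into $k+1$ polygons by $k$ pairwise non-crossing diagonals; $G(n,k)$ denotes the set of $k$-dissections (with vertices labelled $0,\dots,n-1$ in cyclic order, so dissections are distinct sets of diagonals). The cyclic group $Z_n$ acts on $G(n,k)$ by rotating the polygon (vertex $v\mapsto v+1 \bmod n$), and $G(n,k)/Z_n$ is the set of orbits. For a real number $m$, $C_m=\frac{1}{m+1}\binom{2m}{m}$ if $m$ is a nonnegative integer, and $C_m=0$ otherwise. (Equivalently, the count is the number of edges of the $(n-3)$-dimensional associahedron modulo the cyclic action.) -}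

module Defs where

open import Data.Nat using (ℕ; zero; suc; _+_; _*_; _∸_; _≤_; _<_; _≡ᵇ_; _≤ᵇ_; NonZero)
open import Data.Nat.DivMod using (_/_; _%_)
open import Data.Nat.Combinatorics using (_C_)
open import Data.Bool using (Bool; true; false; if_then_else_; _∧_)
open import Data.Fin using (Fin; toℕ)
open import Data.Product using (_×_; _,_; Σ; ∃)
open import Data.List using (List; map; length)
open import Data.List.Relation.Unary.All using (All)
open import Data.List.Relation.Unary.AllPairs using (AllPairs)
open import Data.List.Relation.Unary.Unique.Propositional using (Unique)
open import Data.List.Membership.Propositional using (_∈_)
open import Data.Sum using (_⊎_)
open import Function using (_⇔_)
open import Relation.Nullary using (¬_)
open import Relation.Binary.PropositionalEquality using (_≡_)

Cat : ℕ → ℕ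
Cat m = ((2 * m) C m) / suc m

CatFrac : ℕ → (q : ℕ) → .{{NonZero q}} → ℕ
CatFrac p q = if ((p % q) ≡ᵇ 0) ∧ (1 ≤ᵇ (p / q)) then Cat ((p / q) ∸ 1) else 0

-- Vertices of the n-gon are 0,…,n-1.  A diagonal is stored as the pair (a , b)
-- of its endpoints with a < b.  It is a diagonal (not a side) iff
-- 2 ≤ b - a ≤ n - 2 (the pair (0 , n-1) is the side joining n-1 and 0).
IsDiagonal : ℕ → ℕ × ℕ → Set
IsDiagonal n (a , b) = (b < n) × (2 + a ≤ b) × (b ≤ a + (n ∸ 2))

Cross : ℕ × ℕ → ℕ × ℕ → Set
Cross (a , b) (c , d) = ((a < c) × (c < b) × (b < d)) ⊎ ((c < a) × (a < d) × (d < b))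

NonCrossing : ℕ × ℕ → ℕ × ℕ → Set
NonCrossing x y = ¬ Cross x y

-- A k-dissection of the n-gon: a set (duplicate-free list) of k pairwise
-- non-crossing diagonals.  Two such lists denote the same dissection iff they
-- have the same members (see _≈Rot_ with rotation 0).
record Dissection (n k : ℕ) : Set where
  field
    diags       : List (ℕ × ℕ)
    allDiag     : All (IsDiagonal n) diags
    distinct    : Unique diags
    size        : length diags ≡ k
    nonCrossing : AllPairs NonCrossing diags
open Dissection public

-- rotation v ↦ v+1 mod n applied to a diagonal (a , b), a < b, result again normalised
rot1 : ℕ → ℕ × ℕ → ℕ × ℕ
rot1 n (a , b) = if suc b ≡ᵇ n then (0 , suc a) else (suc a , suc b)

rot : ℕ → ℕ → ℕ × ℕ → ℕ × ℕ
rot n zero    x = x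
rot n (suc r) x = rot1 n (rot n r x)

_≈Rot_ : {n k : ℕ} → Dissection n k → Dissection n k → Set
_≈Rot_ {n} D E = ∃ λ (r : Fin n) → ∀ x → (x ∈ map (rot n (toℕ r)) (diags D)) ⇔ (x ∈ diags E)

-- |G(n,k)/Z_n| = N : there is a system of N orbit representatives, i.e. a map
-- Fin N → G(n,k) hitting every orbit exactly once.
OrbitCount : ℕ → ℕ → ℕ → Set
OrbitCount n k N =
  Σ (Fin N → Dissection n k) λ f →
    (∀ D → ∃ λ i → D ≈Rot f i) × (∀ i j → f i ≈Rot f j → i ≡ j)

{-# OPTIONS --safe #-}

-- An (n−4)-dissection has exactly one quadrilateral, and a triangulated polygon,
-- i.e. a binary tree, hangs on each of its four sides.  Forgetting where the
-- quadrilateral sits in the n-gon identifies the Z_n-orbits with quadruples of binary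
-- trees with n leaves in total, up to cyclic rotation of the quadruple.  By Burnside's
-- lemma for Z_4 there are (F + F₂ + 2 F₁) / 4 of them, where F counts all quadruples,
-- F₂ = C_{n/2−1} those of the form (u, v, u, v) and F₁ = C_{n/4−1} those of the form
-- (u, u, u, u).  Splitting trees at the root gives F = C_{n−1} − 2 C_{n−2}, hence
-- n F = 2 (n−3) C_{n−2}.
--
-- To recover the trees, n-gon chords are lifted to intervals of ℕ: a set of
-- non-crossing chords inside an interval [a, b] either triangulates it, or lacks one
-- chord, and in the latter case the part of the n-gon outside [a, b], seen from the
-- quadrilateral, is again a tree over the interval [b, n + a].
module Submission where

open import Defs
open import Data.Bool using (true; false; T; if_then_else_; _∧_)
open import Data.Empty using (⊥; ⊥-elim)
open import Data.Fin using (Fin; zero; suc; toℕ; fromℕ<)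
open import Data.Fin.Properties using (toℕ-fromℕ<)
open import Data.List using (List; []; _∷_; _++_; map; length; filter; lookup)
open import Data.List.Membership.DecPropositional using () renaming (_∈?_ to mem?)
open import Data.List.Membership.Propositional using (_∈_; _∉_)
open import Data.List.Membership.Propositional.Properties using (∈-map⁺; ∈-map⁻; ∈-++⁺ˡ; ∈-++⁺ʳ; ∈-++⁻; ∈-filter⁺; ∈-filter⁻; ∈-lookup)
open import Data.List.Membership.Propositional.Properties.WithK using (unique∧set⇒bag)
open import Data.List.Properties using (length-map; length-++; map-++; map-∘; map-cong; ++-identityʳ; ++-assoc; filter-notAll; filter-complete; filter-none)
open import Data.List.Relation.Binary.BagAndSetEquality using (∼bag⇒↭)
open import Data.List.Relation.Binary.Permutation.Propositional using (_↭_; ↭-sym; ↭-reflexive; ↭-trans)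
import Data.List.Relation.Binary.Permutation.Propositional.Properties as Permₚ
open import Data.List.Relation.Unary.All as All using (All; []; _∷_)
import Data.List.Relation.Unary.All.Properties as Allₚ
open import Data.List.Relation.Unary.AllPairs as AllPairs using (AllPairs; []; _∷_)
import Data.List.Relation.Unary.AllPairs.Properties as AllPairsₚ
open import Data.List.Relation.Unary.Any using (here; there; index)
open import Data.List.Relation.Unary.Any.Properties using (lookup-index)
open import Data.List.Relation.Unary.Unique.Propositional using (Unique)
import Data.List.Relation.Unary.Unique.Propositional.Properties as Uniqueₚ
open import Data.Nat
open import Data.Nat.Combinatorics using (_C_; nCk+nC[k+1]≡[n+1]C[k+1]; nCk≡nC[n∸k]; nC1≡n)
open import Data.Nat.Combinatorics.Specification using (k>n⇒nCk≡0)
open import Data.Nat.DivMod hiding (_/_; _%_)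
open import Data.Nat.Divisibility using (_∣_; divides; _∣?_; >⇒∤; m%n≡0⇒n∣m)
open import Data.Nat.ListAction using (sum)
open import Data.Nat.ListAction.Properties using (sum-++; sum-↭)
open import Data.Nat.Properties
open import Data.Nat.Tactic.RingSolver using (solve-∀)
open import Data.Product using (_×_; _,_; Σ; ∃; proj₁; proj₂)
open import Data.Product.Properties using (,-injective; ≡-dec)
open import Data.Sum using (_⊎_; inj₁; inj₂; [_,_]′)
open import Data.Unit using (⊤; tt)
open import Data.Vec using (Vec; []; _∷_; _∷ʳ_)
import Data.Vec.Properties as Vecₚ
open import Function using (_∘_; mk⇔; Equivalence)
open import Relation.Binary.Definitions using (DecidableEquality; tri<; tri≈; tri>)
open import Relation.Binary.PropositionalEquality
open import Relation.Nullary using (¬_; Dec; yes; no; ¬?)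
open import Relation.Unary using (Decidable)
open ≡-Reasoning

-- Binary forests and Catalan numbers

-- The delicate point is that a list of chords does not show where the corners of its quadrilateral
-- are. A quadruple therefore comes with a base point `r`, one corner, and two quadruples with the
-- same chord set must be compared without knowing that their base points agree. All rigidity comes
-- from one geometric fact, `no-quadrilateral`: below a triangulated path there is no room for a
-- quadrilateral that no chord cuts. It is used once to show that the trees at a common corner
-- agree, and once to show that a corner of one quadruple cannot lie strictly inside an arc of the
-- other. In the opposite direction the missing chord may be anywhere, so the recursion that reads
-- trees off a dissection carries the number of missing chords and, when it is one, a continuation
-- that waits for the rest of the polygon. Only inclusions of chord sets are read off; equality
-- follows because both sides have `n - 4` distinct members. Binomial and Catalan identities are
-- stated as sums and products, since subtraction and division on naturals truncate.

data Tree : Set where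
  leaf : Tree
  node : Tree → Tree → Tree

leaves : Tree → ℕ
leaves leaf       = 1
leaves (node l r) = leaves l + leaves r

leaves* : ∀ {s} → Vec Tree s → ℕ
leaves* []       = 0
leaves* (t ∷ ts) = leaves t + leaves* ts

leaves>0 : ∀ t → 0 < leaves t
leaves>0 leaf       = s≤s z≤n
leaves>0 (node l r) = ≤-trans (leaves>0 l) (m≤m+n _ _)

s≤leaves* : ∀ {s} (ts : Vec Tree s) → s ≤ leaves* ts
s≤leaves* []       = z≤n
s≤leaves* (t ∷ ts) = +-mono-≤ (leaves>0 t) (s≤leaves* ts)

-- Its inverse trades one internal node for one more tree. Enumerating forests through it, rather
-- than trees by the sizes of their two subtrees, keeps Catalan convolutions out of the count.
merge : ∀ {s} → Vec Tree (2 + s) → Vec Tree (1 + s)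
merge (l ∷ r ∷ ts) = node l r ∷ ts

merge-injective : ∀ {s} {ts us : Vec Tree (2 + s)} → merge ts ≡ merge us → ts ≡ us
merge-injective {ts = _ ∷ _ ∷ _} {_ ∷ _ ∷ _} refl = refl

leaves*-merge : ∀ {s} (ts : Vec Tree (2 + s)) → leaves* (merge ts) ≡ leaves* ts
leaves*-merge (l ∷ r ∷ ts) = +-assoc (leaves l) (leaves r) (leaves* ts)

-- Here m counts the internal nodes; such a forest has m + s leaves.
forests : (m s : ℕ) → List (Vec Tree s)
forests zero    zero    = [] ∷ []
forests (suc m) zero    = []
forests zero    (suc s) = map (leaf ∷_) (forests zero s)
forests (suc m) (suc s) = map (leaf ∷_) (forests (suc m) s) ++ map merge (forests m (2 + s))

forests-unique : ∀ m s → Unique (forests m s)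
forests-unique zero    zero    = [] ∷ []
forests-unique (suc m) zero    = []
forests-unique zero    (suc s) = Uniqueₚ.map⁺ (λ { refl → refl }) (forests-unique zero s)
forests-unique (suc m) (suc s) = Uniqueₚ.++⁺
  (Uniqueₚ.map⁺ (λ { refl → refl }) (forests-unique (suc m) s))
  (Uniqueₚ.map⁺ merge-injective (forests-unique m (2 + s)))
  λ { (p , q) → disjoint (∈-map⁻ _ p) (∈-map⁻ _ q) }
  where
  disjoint : ∀ {v} → (∃ λ ts → ts ∈ forests (suc m) s × v ≡ leaf ∷ ts) →
             (∃ λ us → us ∈ forests m (2 + s) × v ≡ merge us) → ⊥
  disjoint (_ , _ , refl) (_ ∷ _ ∷ _ , _ , ())

∈-leaf∷⁻ : ∀ {s} {fs : List (Vec Tree s)} {ts} → ts ∈ map (leaf ∷_) fs →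
           ∃ λ us → us ∈ fs × leaves* ts ≡ suc (leaves* us)
∈-leaf∷⁻ p with ∈-map⁻ _ p
... | us , q , refl = us , q , refl

∈-merge⁻ : ∀ {s} {fs : List (Vec Tree (2 + s))} {ts} → ts ∈ map merge fs →
           ∃ λ us → us ∈ fs × leaves* ts ≡ leaves* us
∈-merge⁻ p with ∈-map⁻ _ p
... | us , q , refl = us , q , leaves*-merge us

∈-forests⁻ : ∀ m s {ts} → ts ∈ forests m s → leaves* ts ≡ m + s
∈-forests⁻ zero    zero    (here refl) = refl
∈-forests⁻ zero    (suc s) p =
  let us , q , e = ∈-leaf∷⁻ p in trans e (cong suc (∈-forests⁻ zero s q))
∈-forests⁻ (suc m) (suc s) p = [ (λ p₁ →
    let us , q , e = ∈-leaf∷⁻ p₁ in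
    trans e (trans (cong suc (∈-forests⁻ (suc m) s q)) (sym (+-suc (suc m) s))))
  , (λ p₂ →
    let us , q , e = ∈-merge⁻ p₂ in
    trans e (trans (∈-forests⁻ m (2 + s) q) (+-suc m (suc s))))
  ]′ (∈-++⁻ (map (leaf ∷_) (forests (suc m) s)) p)

∈-forests⁺ : ∀ m s ts → leaves* ts ≡ m + s → ts ∈ forests m s
∈-forests⁺ zero    zero    []          _ = here refl
∈-forests⁺ zero    (suc s) (leaf ∷ ts) e = ∈-map⁺ _ (∈-forests⁺ zero s ts (suc-injective e))
-- Splitting this node would give `2 + s` trees, hence at least `2 + s` leaves, against the `1 + s`
-- that `m = 0` allows.
∈-forests⁺ zero    (suc s) (node l r ∷ ts) e =
  ⊥-elim (<-irrefl (sym e) (≤-trans (s≤leaves* (l ∷ r ∷ ts)) (≤-reflexive (sym (leaves*-merge (l ∷ r ∷ ts))))))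
∈-forests⁺ (suc m) (suc s) (leaf ∷ ts) e =
  ∈-++⁺ˡ (∈-map⁺ _ (∈-forests⁺ (suc m) s ts (trans (suc-injective e) (+-suc m s))))
∈-forests⁺ (suc m) (suc s) (node l r ∷ ts) e = ∈-++⁺ʳ (map (leaf ∷_) (forests (suc m) s))
  (∈-map⁺ merge (∈-forests⁺ m (2 + s) (l ∷ r ∷ ts)
    (trans (sym (leaves*-merge (l ∷ r ∷ ts))) (trans e (sym (+-suc m (suc s)))))))

-- Ballot numbers and Catalan identities

#forests : ℕ → ℕ → ℕ
#forests m s = length (forests m s)

#forests-suc : ∀ m s → #forests (suc m) (suc s) ≡ #forests (suc m) s + #forests m (2 + s)
#forests-suc m s = trans (length-++ (map (leaf ∷_) (forests (suc m) s)))
  (cong₂ _+_ (length-map _ (forests (suc m) s)) (length-map merge (forests m (2 + s))))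

#forests-zero : ∀ s → #forests 0 s ≡ 1
#forests-zero zero    = refl
#forests-zero (suc s) = trans (length-map _ (forests 0 s)) (#forests-zero s)

pascal : ∀ n k → suc n C suc k ≡ n C k + n C suc k
pascal n k = sym (nCk+nC[k+1]≡[n+1]C[k+1] n k)

-- The forest counts are ballot numbers, differences of adjacent binomial coefficients. Pascal's
-- rule matches the recursion of `#forests-suc`; at `s = 0` the forest count vanishes and the two
-- coefficients are the equal middle entries of row `2m + 1`.
#forests-binomial : ∀ m s →
  #forests (suc m) s + (suc (m + m) + s) C m ≡ (suc (m + m) + s) C suc m
#forests-binomial m zero = begin
  suc (m + m + 0) C m                   ≡⟨ cong (λ k → suc k C m) (+-identityʳ (m + m)) ⟩
  suc (m + m) C m                       ≡⟨ nCk≡nC[n∸k] (m≤n⇒m≤1+n (m≤m+n m m)) ⟩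
  suc (m + m) C (suc (m + m) ∸ m)       ≡⟨ cong (suc (m + m) C_) (m+n∸n≡m (suc m) m) ⟩
  suc (m + m) C suc m                   ≡⟨ cong (λ k → suc k C suc m) (+-identityʳ (m + m)) ⟨
  suc (m + m + 0) C suc m               ∎
#forests-binomial zero (suc s) = begin
  #forests 1 (suc s) + 1                   ≡⟨ cong (_+ 1) (#forests-suc 0 s) ⟩
  #forests 1 s + #forests 0 (2 + s) + 1    ≡⟨ cong (λ k → #forests 1 s + k + 1) (#forests-zero (2 + s)) ⟩
  #forests 1 s + 1 + 1                     ≡⟨ cong (_+ 1) (#forests-binomial 0 s) ⟩
  suc s C 1 + 1                            ≡⟨ cong (_+ 1) (nC1≡n (suc s)) ⟩
  suc s + 1                                ≡⟨ +-comm (suc s) 1 ⟩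
  2 + s                                    ≡⟨ nC1≡n (2 + s) ⟨
  (2 + s) C 1                              ∎
#forests-binomial (suc m) (suc s) = begin
  #forests (2 + m) (suc s) + (w + suc s) C suc m
    ≡⟨ cong₂ (λ a k → a + k C suc m) (#forests-suc (suc m) s) (+-suc w s) ⟩
  #forests (2 + m) s + #forests (suc m) (2 + s) + suc (w + s) C suc m
    ≡⟨ cong (#forests (2 + m) s + #forests (suc m) (2 + s) +_) (pascal (w + s) m) ⟩
  #forests (2 + m) s + #forests (suc m) (2 + s) + ((w + s) C m + (w + s) C suc m)
    ≡⟨ regroup (#forests (2 + m) s) (#forests (suc m) (2 + s)) ((w + s) C m) ((w + s) C suc m) ⟩
  (#forests (suc m) (2 + s) + (w + s) C m) + (#forests (2 + m) s + (w + s) C suc m)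
    ≡⟨ cong₂ _+_ below (#forests-binomial (suc m) s) ⟩
  (w + s) C suc m + (w + s) C (2 + m)
    ≡⟨ pascal (w + s) (suc m) ⟨
  suc (w + s) C (2 + m)
    ≡⟨ cong (_C (2 + m)) (+-suc w s) ⟨
  (w + suc s) C (2 + m) ∎
  where
  w = suc (suc m + suc m)
  regroup : ∀ a b c d → a + b + (c + d) ≡ (b + c) + (a + d)
  regroup = solve-∀
  top : ∀ m s → suc (m + m) + (2 + s) ≡ suc (suc m + suc m) + s
  top = solve-∀
  below : #forests (suc m) (2 + s) + (w + s) C m ≡ (w + s) C suc m
  below = subst (λ k → #forests (suc m) (2 + s) + k C m ≡ k C suc m) (top m s) (#forests-binomial m (2 + s))

absorption : ∀ n k → suc k * (suc n C suc k) ≡ suc n * (n C k)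
absorption n       zero    = begin
  1 * (suc n C 1) ≡⟨ *-identityˡ _ ⟩
  suc n C 1       ≡⟨ nC1≡n (suc n) ⟩
  suc n           ≡⟨ *-identityʳ (suc n) ⟨
  suc n * 1       ∎
absorption zero    (suc k) = begin
  suc (suc k) * (1 C suc (suc k)) ≡⟨ cong (suc (suc k) *_) (k>n⇒nCk≡0 {1} {suc (suc k)} (s≤s (s≤s z≤n))) ⟩
  suc (suc k) * 0                 ≡⟨ *-zeroʳ (suc (suc k)) ⟩
  1 * 0                           ≡⟨ cong (1 *_) (k>n⇒nCk≡0 {0} {suc k} (s≤s z≤n)) ⟨
  1 * (0 C suc k)                 ∎
absorption (suc n) (suc k) = begin
  suc (suc k) * (suc (suc n) C suc (suc k))
    ≡⟨ cong (suc (suc k) *_) (pascal (suc n) (suc k)) ⟩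
  suc (suc k) * (a + suc n C suc (suc k))
    ≡⟨ *-distribˡ-+ (suc (suc k)) a _ ⟩
  (a + suc k * a) + suc (suc k) * (suc n C suc (suc k))
    ≡⟨ cong₂ (λ x y → a + x + y) (absorption n k) (absorption n (suc k)) ⟩
  a + suc n * (n C k) + suc n * (n C suc k)
    ≡⟨ regroup a (suc n) (n C k) (n C suc k) ⟩
  a + suc n * (n C k + n C suc k)
    ≡⟨ cong (λ x → a + suc n * x) (pascal n k) ⟨
  a + suc n * a ∎
  where
  a = suc n C suc k
  regroup : ∀ a p b c → a + p * b + p * c ≡ a + p * (b + c)
  regroup = solve-∀

-- (n − k) C(n,k) = (k + 1) C(n,k+1), with n = k + j.
descent : ∀ k j → suc k * ((k + j) C suc k) ≡ j * ((k + j) C k)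
descent k j = +-cancelˡ-≡ (suc k * c) _ _ (begin
  suc k * c + suc k * ((k + j) C suc k) ≡⟨ *-distribˡ-+ (suc k) c _ ⟨
  suc k * (c + (k + j) C suc k)         ≡⟨ cong (suc k *_) (pascal (k + j) k) ⟨
  suc k * (suc (k + j) C suc k)         ≡⟨ absorption (k + j) k ⟩
  (suc k + j) * c                       ≡⟨ *-distribʳ-+ c (suc k) j ⟩
  suc k * c + j * c                     ∎)
  where c = (k + j) C k

-- The ballot formula gives the count as `y - x`, and `descent` gives `(m + 1) y = (m + 2) x`, so
-- that `(m + 2) (y - x) = y`.
#trees-binomial : ∀ m → #forests m 1 * suc m ≡ (2 * m) C m
#trees-binomial zero    = refl
#trees-binomial (suc m) = +-cancelʳ-≡ (x * suc (suc m)) _ _ (begin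
  f * suc (suc m) + x * suc (suc m) ≡⟨ *-distribʳ-+ (suc (suc m)) f x ⟨
  (f + x) * suc (suc m)             ≡⟨ cong (_* suc (suc m)) ballot ⟩
  y * suc (suc m)                   ≡⟨ *-suc y (suc m) ⟩
  y + y * suc m                     ≡⟨ cong (y +_) (*-comm y (suc m)) ⟩
  y + suc m * y                     ≡⟨ cong (y +_) desc ⟩
  y + suc (suc m) * x               ≡⟨ cong (y +_) (*-comm (suc (suc m)) x) ⟩
  y + x * suc (suc m)               ∎)
  where
  f = #forests (suc m) 1
  x = (2 * suc m) C m
  y = (2 * suc m) C suc m
  ballot : f + x ≡ y
  ballot = subst (λ k → f + k C m ≡ k C suc m) (top m) (#forests-binomial m 1)
    where
    top : ∀ m → suc (m + m) + 1 ≡ 2 * suc m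
    top = solve-∀
  desc : suc m * y ≡ suc (suc m) * x
  desc = subst (λ k → suc m * (k C suc m) ≡ suc (suc m) * (k C m)) (top m) (descent m (suc (suc m)))
    where
    top : ∀ m → m + suc (suc m) ≡ 2 * suc m
    top = solve-∀

#trees≡Cat : ∀ m → #forests m 1 ≡ Cat m
#trees≡Cat m = begin
  #forests m 1                     ≡⟨ m*n/n≡m (#forests m 1) (suc m) ⟨
  #forests m 1 * suc m / suc m     ≡⟨ cong (_/ suc m) (#trees-binomial m) ⟩
  Cat m                            ∎

-- A tree that is not a leaf is the pair of subtrees at its root; the other summand in
-- `#forests-suc m 0` counts empty forests with an internal node and is zero.
#pairs≡Cat : ∀ m → #forests m 2 ≡ Cat (suc m)
#pairs≡Cat m = trans (sym (#forests-suc m 0)) (#trees≡Cat (suc m))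

central : ∀ m → suc m * ((2 * suc m) C suc m) ≡ 2 * (suc (2 * m) * ((2 * m) C m))
central m = *-cancelˡ-≡ _ _ (suc m) (begin
  suc m * (suc m * ((2 * suc m) C suc m))
    ≡⟨ cong (λ k → suc m * (suc m * (k C suc m))) (top m) ⟩
  suc m * (suc m * (suc (suc (2 * m)) C suc m))
    ≡⟨ cong (suc m *_) (absorption (suc (2 * m)) m) ⟩
  suc m * (suc (suc (2 * m)) * (suc (2 * m) C m))
    ≡⟨ swap₁ m (suc (2 * m) C m) ⟩
  2 * (suc m * (suc m * (suc (2 * m) C m)))
    ≡⟨ cong (λ x → 2 * (suc m * x)) symmetric ⟩
  2 * (suc m * (suc m * (suc (2 * m) C suc m)))
    ≡⟨ cong (λ x → 2 * (suc m * x)) (absorption (2 * m) m) ⟩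
  2 * (suc m * (suc (2 * m) * ((2 * m) C m)))
    ≡⟨ swap₂ (suc m) (suc (2 * m) * ((2 * m) C m)) ⟩
  suc m * (2 * (suc (2 * m) * ((2 * m) C m))) ∎)
  where
  top : ∀ m → 2 * suc m ≡ suc (suc (2 * m))
  top = solve-∀
  swap₁ : ∀ m x → suc m * (suc (suc (2 * m)) * x) ≡ 2 * (suc m * (suc m * x))
  swap₁ = solve-∀
  swap₂ : ∀ a b → 2 * (a * b) ≡ a * (2 * b)
  swap₂ = solve-∀
  symmetric : suc m * (suc (2 * m) C m) ≡ suc m * (suc (2 * m) C suc m)
  symmetric = sym (subst (λ k → suc m * (k C suc m) ≡ suc m * (k C m)) (odd m) (descent m (suc m)))
    where
    odd : ∀ m → m + suc m ≡ suc (2 * m)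
    odd = solve-∀

-- `Cat` is a truncated quotient, so a recurrence for it needs the division to be exact.
-- `#trees-binomial` supplies this, the quotient being a number of trees.
Cat-suc : ∀ m → (2 + m) * Cat (suc m) ≡ 2 * (suc (2 * m) * Cat m)
Cat-suc m = *-cancelˡ-≡ _ _ (suc m) (begin
  suc m * ((2 + m) * Cat (suc m))
    ≡⟨ cong (suc m *_) (trans (cong ((2 + m) *_) (sym (#trees≡Cat (suc m)))) (trans (*-comm (2 + m) (#forests (suc m) 1)) (#trees-binomial (suc m)))) ⟩
  suc m * ((2 * suc m) C suc m)
    ≡⟨ central m ⟩
  2 * (suc (2 * m) * ((2 * m) C m))
    ≡⟨ cong (λ x → 2 * (suc (2 * m) * x)) (trans (sym (#trees-binomial m)) (cong (_* suc m) (#trees≡Cat m))) ⟩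
  2 * (suc (2 * m) * (Cat m * suc m))
    ≡⟨ regroup m (Cat m) ⟩
  suc m * (2 * (suc (2 * m) * Cat m)) ∎)
  where
  regroup : ∀ m c → 2 * (suc (2 * m) * (c * suc m)) ≡ suc m * (2 * (suc (2 * m) * c))
  regroup = solve-∀

#quadruples : ∀ m → (4 + m) * #forests m 4 ≡ 2 * suc m * Cat (2 + m)
#quadruples m = +-cancelˡ-≡ ((4 + m) * (2 * c)) _ _ (begin
  (4 + m) * (2 * c) + (4 + m) * q        ≡⟨ *-distribˡ-+ (4 + m) (2 * c) q ⟨
  (4 + m) * (2 * c + q)                  ≡⟨ cong ((4 + m) *_) split ⟨
  (4 + m) * Cat (3 + m)                  ≡⟨ Cat-suc (2 + m) ⟩
  2 * (suc (2 * (2 + m)) * c)            ≡⟨ regroup m c ⟩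
  (4 + m) * (2 * c) + 2 * suc m * c      ∎)
  where
  c = Cat (2 + m)
  q = #forests m 4
  regroup : ∀ m c → 2 * (suc (2 * (2 + m)) * c) ≡ (4 + m) * (2 * c) + 2 * suc m * c
  regroup = solve-∀
  double : ∀ c q → c + (c + q) ≡ 2 * c + q
  double = solve-∀
  split : Cat (3 + m) ≡ 2 * c + q
  -- One `c` counts the pairs that begin with a leaf, the other the triples that begin with a leaf;
  -- splitting the leading node in the remaining ones leaves the quadruples.
  split = begin
    Cat (3 + m)                            ≡⟨ #pairs≡Cat (2 + m) ⟨
    #forests (2 + m) 2                     ≡⟨ #forests-suc (1 + m) 1 ⟩
    #forests (2 + m) 1 + #forests (1 + m) 3
      ≡⟨ cong₂ _+_ (#trees≡Cat (2 + m)) (trans (#forests-suc m 2) (cong (_+ q) (#pairs≡Cat (1 + m)))) ⟩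
    c + (c + q)                            ≡⟨ double c q ⟩
    2 * c + q                              ∎

CatFrac-multiple : ∀ p d .{{_ : NonZero d}} → CatFrac (suc p * d) d ≡ Cat p
CatFrac-multiple p d = aux (m*n%n≡0 (suc p) d) (m*n/n≡m (suc p) d)
  where
  aux : ∀ {r q} → r ≡ 0 → q ≡ suc p → (if (r ≡ᵇ 0) ∧ (1 ≤ᵇ q) then Cat (q ∸ 1) else 0) ≡ Cat p
  aux refl refl = refl

CatFrac-∤ : ∀ n d .{{_ : NonZero d}} → ¬ d ∣ n → CatFrac n d ≡ 0
CatFrac-∤ n d d∤n with n % d in eq
... | zero  = ⊥-elim (d∤n (m%n≡0⇒n∣m n d eq))
... | suc _ = refl

-- Burnside's lemma for a cyclic group of order four

unique∧set⇒↭ : ∀ {A : Set} {xs ys : List A} → Unique xs → Unique ys →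
               (∀ {x} → x ∈ xs → x ∈ ys) → (∀ {x} → x ∈ ys → x ∈ xs) → xs ↭ ys
unique∧set⇒↭ u v f g = ∼bag⇒↭ (unique∧set⇒bag u v (mk⇔ f g))

module Rotation {X : Set} (_≟_ : DecidableEquality X) (ρ : X → X)
                (ρ⁴ : ∀ x → ρ (ρ (ρ (ρ x))) ≡ x) where

  iter : ℕ → X → X
  iter zero    x = x
  iter (suc k) x = ρ (iter k x)

  _~_ : X → X → Set
  x ~ y = ∃ λ k → iter k x ≡ y

  iter-+ : ∀ j k x → iter j (iter k x) ≡ iter (j + k) x
  iter-+ zero    k x = refl
  iter-+ (suc j) k x = cong ρ (iter-+ j k x)

  iter-4 : ∀ k x → iter (k * 4) x ≡ x
  iter-4 zero    x = refl
  iter-4 (suc k) x = trans (ρ⁴ (iter (k * 4) x)) (iter-4 k x)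

  -- `_~_` uses forward powers only; the inverse of `k` rotations is `3 * k` more, which makes a
  -- multiple of four.
  ~-sym : ∀ {x y} → x ~ y → y ~ x
  ~-sym {x} (k , refl) = 3 * k , trans (iter-+ (3 * k) k x) (trans (cong (λ j → iter j x) (lem k)) (iter-4 k x))
    where
    lem : ∀ k → 3 * k + k ≡ k * 4
    lem = solve-∀

  -- Repetitions are allowed here: membership in this list is a decidable form of `_~_`. The
  -- duplicate-free version is in `Orbit`.
  orbit : X → List X
  orbit x = x ∷ ρ x ∷ ρ (ρ x) ∷ ρ (ρ (ρ x)) ∷ []

  _∈?_ : ∀ x xs → Dec (x ∈ xs)
  _∈?_ = mem? _≟_

  ρ-orbit : ∀ {x y} → y ∈ orbit x → ρ y ∈ orbit x
  ρ-orbit (here refl)                         = there (here refl)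
  ρ-orbit (there (here refl))                 = there (there (here refl))
  ρ-orbit (there (there (here refl)))         = there (there (there (here refl)))
  ρ-orbit (there (there (there (here refl)))) = here (ρ⁴ _)

  ρ-orbit⁻ : ∀ {x y} → ρ y ∈ orbit x → y ∈ orbit x
  ρ-orbit⁻ {x} p = subst (_∈ orbit x) (ρ⁴ _) (ρ-orbit (ρ-orbit (ρ-orbit p)))

  ~⇒∈orbit : ∀ {x y} → x ~ y → y ∈ orbit x
  ~⇒∈orbit (zero  , refl) = here refl
  ~⇒∈orbit (suc k , refl) = ρ-orbit (~⇒∈orbit (k , refl))

  ∈orbit⇒~ : ∀ {x y} → y ∈ orbit x → x ~ y
  ∈orbit⇒~ (here refl)                         = 0 , refl
  ∈orbit⇒~ (there (here refl))                 = 1 , refl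
  ∈orbit⇒~ (there (there (here refl)))         = 2 , refl
  ∈orbit⇒~ (there (there (there (here refl)))) = 3 , refl

  indicator : ∀ {P : Set} → Dec P → ℕ
  indicator (yes _) = 1
  indicator (no _)  = 0

  -- The number of elements of Z/4 that fix x.
  weight : X → ℕ
  weight x = 1 + indicator (ρ (ρ x) ≟ x) + 2 * indicator (ρ x ≟ x)

  weights : List X → ℕ
  weights xs = sum (map weight xs)

  weights-++ : ∀ xs ys → weights (xs ++ ys) ≡ weights xs + weights ys
  weights-++ xs ys = trans (cong sum (map-++ weight xs ys)) (sum-++ (map weight xs) (map weight ys))

  weights-↭ : ∀ {xs ys} → xs ↭ ys → weights xs ≡ weights ys
  weights-↭ p = sum-↭ (Permₚ.map⁺ weight p)

  indicator-yes : ∀ {P : Set} (d : Dec P) → P → indicator d ≡ 1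
  indicator-yes (yes _) _ = refl
  indicator-yes (no ¬p) p = ⊥-elim (¬p p)

  indicator-no : ∀ {P : Set} (d : Dec P) → ¬ P → indicator d ≡ 0
  indicator-no (yes p) ¬p = ⊥-elim (¬p p)
  indicator-no (no _)  _  = refl

  weight-fixed : ∀ x → ρ x ≡ x → weight x ≡ 4
  weight-fixed x e = cong₂ (λ a b → 1 + a + 2 * b)
    (indicator-yes (ρ (ρ x) ≟ x) (trans (cong ρ e) e)) (indicator-yes (ρ x ≟ x) e)

  weight-half : ∀ x → ρ (ρ x) ≡ x → ρ x ≢ x → weight x ≡ 2
  weight-half x e ne = cong₂ (λ a b → 1 + a + 2 * b)
    (indicator-yes (ρ (ρ x) ≟ x) e) (indicator-no (ρ x ≟ x) ne)

  weight-free : ∀ x → ρ (ρ x) ≢ x → weight x ≡ 1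
  weight-free x ne = cong₂ (λ a b → 1 + a + 2 * b)
    (indicator-no (ρ (ρ x) ≟ x) ne) (indicator-no (ρ x ≟ x) (λ e → ne (trans (cong ρ e) e)))

  ρ-injective : ∀ {x y} → ρ x ≡ ρ y → x ≡ y
  ρ-injective e = trans (sym (ρ⁴ _)) (trans (cong (ρ ∘ ρ ∘ ρ) e) (ρ⁴ _))

  -- `weigh` is the orbit-stabilizer theorem: orbits of size 1, 2 and 4 have stabilizers of order 4,
  -- 2 and 1.
  record Orbit (x : X) : Set where
    field
      elements : List X
      unique   : Unique elements
      sound    : ∀ {y} → y ∈ elements → y ∈ orbit x
      complete : ∀ {y} → y ∈ orbit x → y ∈ elements
      weigh    : weights elements ≡ 4

  mkOrbit : ∀ x → Orbit x
  mkOrbit x with ρ x ≟ x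
  ... | yes e = record
    { elements = x ∷ []
    ; unique   = [] ∷ []
    ; sound    = λ { (here refl) → here refl }
    ; complete = λ { (here refl)                         → here refl
                   ; (there (here refl))                 → here e
                   ; (there (there (here refl)))         → here (trans (cong ρ e) e)
                   ; (there (there (there (here refl)))) → here (trans (cong ρ (trans (cong ρ e) e)) e) }
    ; weigh    = cong (_+ 0) (weight-fixed x e) }
  ... | no ne with ρ (ρ x) ≟ x
  ...   | yes e = record
    { elements = x ∷ ρ x ∷ []
    ; unique   = ((ne ∘ sym) ∷ []) ∷ [] ∷ []
    ; sound    = λ { (here refl) → here refl ; (there (here refl)) → there (here refl) }
    ; complete = λ { (here refl)                         → here refl
                   ; (there (here refl))                 → there (here refl)
                   ; (there (there (here refl)))         → here e
                   ; (there (there (there (here refl)))) → there (here (cong ρ e)) }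
    ; weigh    = cong₂ (λ a b → a + (b + 0)) (weight-half x e ne) (weight-half (ρ x) (cong ρ e) (ne ∘ ρ-injective)) }
  ...   | no ne₂ = record
    { elements = orbit x
    ; unique   = ((ne ∘ sym) ∷ (ne₂ ∘ sym) ∷ (λ e → ne (trans (cong ρ e) (ρ⁴ x))) ∷ [])
               ∷ ((ne ∘ ρ-injective ∘ sym) ∷ (ne₂ ∘ ρ-injective ∘ sym) ∷ [])
               ∷ ((ne ∘ ρ-injective ∘ ρ-injective ∘ sym) ∷ []) ∷ [] ∷ []
    ; sound    = λ p → p
    ; complete = λ p → p
    ; weigh    = cong₂ _+_ (weight-free x ne₂) (cong₂ _+_ (weight-free (ρ x) (ne₂ ∘ ρ-injective))
                   (cong₂ _+_ (weight-free (ρ (ρ x)) (ne₂ ∘ ρ-injective ∘ ρ-injective))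
                     (cong (_+ 0) (weight-free (ρ (ρ (ρ x))) (ne₂ ∘ ρ-injective ∘ ρ-injective ∘ ρ-injective))))) }

  record Transversal (L : List X) : Set where
    field
      reps     : List X
      ⊆L       : ∀ {x} → x ∈ reps → x ∈ L
      separate : AllPairs (λ x y → ¬ x ~ y) reps
      cover    : ∀ {x} → x ∈ L → ∃ λ y → y ∈ reps × x ~ y
      count    : 4 * length reps ≡ weights L

  -- Each round filters out the whole orbit of the head, which is not structural recursion, so `k`
  -- serves as fuel. What remains is again closed under `ρ` because `ρ` cannot lead into an orbit
  -- from outside.
  transversal′ : ∀ k (L : List X) → length L ≤ k → Unique L → (∀ {x} → x ∈ L → ρ x ∈ L) → Transversal L
  transversal′ _ [] _ _ _ = record
    { reps = [] ; ⊆L = λ () ; separate = [] ; cover = λ () ; count = refl }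
  transversal′ zero    (_ ∷ _) ()
  transversal′ (suc k) L@(x ∷ _) L≤k uniq closed = record
    { reps     = x ∷ R.reps
    ; ⊆L       = λ { (here refl) → here refl ; (there p) → proj₁ (∈-filter⁻ outside? (R.⊆L p)) }
    ; separate = All.tabulate (λ y∈R x~y → proj₂ (∈-filter⁻ outside? (R.⊆L y∈R)) (~⇒∈orbit x~y)) ∷ R.separate
    ; cover    = cov
    ; count    = begin
        4 * suc (length R.reps)         ≡⟨ *-suc 4 (length R.reps) ⟩
        4 + 4 * length R.reps           ≡⟨ cong₂ _+_ (sym O.weigh) R.count ⟩
        weights O.elements + weights L′ ≡⟨ weights-++ O.elements L′ ⟨
        weights (O.elements ++ L′)      ≡⟨ weights-↭ perm ⟨
        weights L                       ∎ }
    where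
    outside? = λ y → ¬? (y ∈? orbit x)
    L′ = filter outside? L
    module O = Orbit (mkOrbit x)

    shorter : length L′ ≤ k
    shorter = ≤-pred (≤-trans (filter-notAll outside? L (here (λ ¬p → ¬p (here refl)))) L≤k)

    closed′ : ∀ {y} → y ∈ L′ → ρ y ∈ L′
    closed′ p = let q , y∉ = ∈-filter⁻ outside? p in ∈-filter⁺ outside? (closed q) (y∉ ∘ ρ-orbit⁻)

    module R = Transversal (transversal′ k L′ shorter (Uniqueₚ.filter⁺ outside? uniq) closed′)

    orbit⊆L : ∀ {y} → y ∈ orbit x → y ∈ L
    orbit⊆L (here refl)                         = here refl
    orbit⊆L (there (here refl))                 = closed (here refl)
    orbit⊆L (there (there (here refl)))         = closed (closed (here refl))
    orbit⊆L (there (there (there (here refl)))) = closed (closed (closed (here refl)))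

    perm : L ↭ O.elements ++ L′
    perm = unique∧set⇒↭ uniq
      (Uniqueₚ.++⁺ O.unique (Uniqueₚ.filter⁺ outside? uniq)
        (λ { (p , q) → proj₂ (∈-filter⁻ outside? q) (O.sound p) }))
      to from
      where
      to : ∀ {y} → y ∈ L → y ∈ O.elements ++ L′
      to {y} p with y ∈? orbit x
      ... | yes q = ∈-++⁺ˡ (O.complete q)
      ... | no ¬q = ∈-++⁺ʳ O.elements (∈-filter⁺ outside? p ¬q)
      from : ∀ {y} → y ∈ O.elements ++ L′ → y ∈ L
      from p with ∈-++⁻ O.elements p
      ... | inj₁ q = orbit⊆L (O.sound q)
      ... | inj₂ q = proj₁ (∈-filter⁻ outside? q)

    cov : ∀ {y} → y ∈ L → ∃ λ z → z ∈ x ∷ R.reps × y ~ z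
    cov {y} p with y ∈? orbit x
    ... | yes q = x , here refl , ~-sym (∈orbit⇒~ q)
    ... | no ¬q = let z , z∈R , y~z = R.cover (∈-filter⁺ outside? p ¬q) in z , there z∈R , y~z

  transversal : ∀ L → Unique L → (∀ {x} → x ∈ L → ρ x ∈ L) → Transversal L
  transversal L = transversal′ (length L) L ≤-refl

  -- The double count of Burnside: stabilizers summed over elements become fixed points summed over
  -- rotations. The factor 2 stands for `ρ` and its inverse, which fix the same elements.
  weights-count : ∀ L → weights L ≡ length L + length (filter (λ x → ρ (ρ x) ≟ x) L)
                                   + 2 * length (filter (λ x → ρ x ≟ x) L)
  weights-count [] = refl
  weights-count (x ∷ L) = trans (cong (weight x +_) (weights-count L)) step
    where
    step : weight x + (length L + length (filter (λ x → ρ (ρ x) ≟ x) L) + 2 * length (filter (λ x → ρ x ≟ x) L))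
         ≡ length (x ∷ L) + length (filter (λ x → ρ (ρ x) ≟ x) (x ∷ L)) + 2 * length (filter (λ x → ρ x ≟ x) (x ∷ L))
    step with ρ (ρ x) ≟ x | ρ x ≟ x
    ... | yes _ | yes _ = lem (length L) _ _
      where lem : ∀ a b c → 4 + (a + b + 2 * c) ≡ suc a + suc b + 2 * suc c
            lem = solve-∀
    ... | yes _ | no _  = lem (length L) _ (length (filter (λ x → ρ x ≟ x) L))
      where lem : ∀ a b c → 2 + (a + b + 2 * c) ≡ suc a + suc b + 2 * c
            lem = solve-∀
    ... | no _  | yes _ = lem (length L) _ _
      where lem : ∀ a b c → 3 + (a + b + 2 * c) ≡ suc a + b + 2 * suc c
            lem = solve-∀
    ... | no _  | no _  = refl

-- Chords of the n-gon as residues of integer intervals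

sort : ℕ → ℕ → ℕ × ℕ
sort p q = p ⊓ q , p ⊔ q

sort-comm : ∀ p q → sort p q ≡ sort q p
sort-comm p q = cong₂ _,_ (⊓-comm p q) (⊔-comm p q)

sort-≤ : ∀ {p q} → p ≤ q → sort p q ≡ (p , q)
sort-≤ p≤q = cong₂ _,_ (m≤n⇒m⊓n≡m p≤q) (m≤n⇒m⊔n≡n p≤q)

sorted : ∀ p q → sort p q ≡ (p , q) ⊎ sort p q ≡ (q , p)
sorted p q = [ inj₁ ∘ sort-≤ , (λ q≤p → inj₂ (trans (sort-comm p q) (sort-≤ q≤p))) ]′ (≤-total p q)

sort-injective : ∀ {p q p′ q′} → sort p q ≡ sort p′ q′ → (p ≡ p′ × q ≡ q′) ⊎ (p ≡ q′ × q ≡ p′)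
sort-injective {p} {q} {p′} {q′} e with sorted p q | sorted p′ q′
... | inj₁ f | inj₁ g = inj₁ (,-injective (trans (sym f) (trans e g)))
... | inj₁ f | inj₂ g = inj₂ (,-injective (trans (sym f) (trans e g)))
... | inj₂ f | inj₁ g = let a , b = ,-injective (trans (sym f) (trans e g)) in inj₂ (b , a)
... | inj₂ f | inj₂ g = let a , b = ,-injective (trans (sym f) (trans e g)) in inj₁ (b , a)

shift : ℕ → ℕ × ℕ → ℕ × ℕ
shift k (x , y) = k + x , k + y

rot1-wrap : ∀ {n} a b → suc b ≡ n → rot1 n (a , b) ≡ (0 , suc a)
rot1-wrap a b refl with b ≡ᵇ b in eq
... | true  = refl
... | false = ⊥-elim (subst T eq (≡⇒≡ᵇ b b refl))

rot1-step : ∀ {n} a b → suc b ≢ n → rot1 n (a , b) ≡ (suc a , suc b)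
rot1-step {n} a b ne with suc b ≡ᵇ n in eq
... | true  = ⊥-elim (ne (≡ᵇ⇒≡ (suc b) n (subst T (sym eq) tt)))
... | false = refl

module Cyclic (n : ℕ) .{{_ : NonZero n}} where

  -- The chord of the n-gon joining the residues of two integer points, in the
  -- normal form used for diagonals.
  chord : ℕ × ℕ → ℕ × ℕ
  chord (x , y) = sort (x % n) (y % n)

  chord-comm : ∀ x y → chord (x , y) ≡ chord (y , x)
  chord-comm x y = sort-comm (x % n) (y % n)

  chord-< : ∀ {x y} → x < y → y < n → chord (x , y) ≡ (x , y)
  chord-< x<y y<n = trans (cong₂ sort (m<n⇒m%n≡m (<-trans x<y y<n)) (m<n⇒m%n≡m y<n)) (sort-≤ (<⇒≤ x<y))

  period : ∀ k x → (k * n + x) % n ≡ x % n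
  period k x = trans (cong (_% n) (+-comm (k * n) x)) ([m+kn]%n≡m%n x k n)

  period₁ : ∀ x → (n + x) % n ≡ x % n
  period₁ x = trans (cong (_% n) (+-comm n x)) ([m+n]%n≡m%n x n)

  chord-period : ∀ k p → chord (shift (k * n) p) ≡ chord p
  chord-period k (x , y) = cong₂ sort (period k x) (period k y)

  chord-period₁ : ∀ p → chord (shift n p) ≡ chord p
  chord-period₁ (x , y) = cong₂ sort (period₁ x) (period₁ y)

  chord-wrap : ∀ x y → chord (x , n + y) ≡ chord (y , x)
  chord-wrap x y = trans (cong (sort (x % n)) (period₁ y)) (chord-comm x y)

  -- The window includes both `c` and its copy `n + c`, because intervals that start at a base point
  -- may end at its next copy. In between, the distance to `c` would be a positive multiple of `n`
  -- below `n`.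
  %-window : ∀ {c x} → c ≤ x → x ≤ n + c → c % n ≡ x % n → c ≡ x ⊎ x ≡ n + c
  %-window {c} {x} c≤x x≤n+c e with m≤n⇒m<n∨m≡n x≤n+c
  ... | inj₂ eq = inj₂ eq
  ... | inj₁ lt with x ∸ c in eq
  ...   | zero  = inj₁ (≤-antisym c≤x (m∸n≡0⇒m≤n eq))
  ...   | suc k = ⊥-elim (>⇒∤ (+-cancelʳ-< c (suc k) n (subst (_< n + c) x≡ lt)) (divides (x / n ∸ c / n) (trans (sym eq) dist)))
    where
    x≡ : x ≡ suc k + c
    x≡ = trans (sym (m∸n+n≡m c≤x)) (cong (_+ c) eq)
    dist : x ∸ c ≡ (x / n ∸ c / n) * n
    dist = begin
      x ∸ c                                          ≡⟨ cong₂ _∸_ (m≡m%n+[m/n]*n x n) (m≡m%n+[m/n]*n c n) ⟩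
      (x % n + x / n * n) ∸ (c % n + c / n * n)      ≡⟨ cong (λ z → (x % n + x / n * n) ∸ (z + c / n * n)) e ⟩
      (x % n + x / n * n) ∸ (x % n + c / n * n)      ≡⟨ [m+n]∸[m+o]≡n∸o (x % n) _ _ ⟩
      x / n * n ∸ c / n * n                          ≡⟨ *-distribʳ-∸ n (x / n) (c / n) ⟨
      (x / n ∸ c / n) * n                            ∎

  %-window-≢ : ∀ {c x} → c < x → x < n + c → c % n ≢ x % n
  %-window-≢ c<x x<n+c e with %-window (<⇒≤ c<x) (<⇒≤ x<n+c) e
  ... | inj₁ refl = <-irrefl refl c<x
  ... | inj₂ refl = <-irrefl refl x<n+c

  suc-% : ∀ x → suc x % n ≡ suc (x % n) % n
  suc-% x = trans (cong (λ z → suc z % n) (m≡m%n+[m/n]*n x n)) ([m+kn]%n≡m%n (suc (x % n)) (x / n) n)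

  rot1-sort : ∀ {p q} → p < q → q < n → rot1 n (p , q) ≡ sort (suc p % n) (suc q % n)
  rot1-sort {p} {q} p<q q<n with suc q ≟ n
  ... | yes refl = trans (rot1-wrap p q refl)
    (sym (trans (cong₂ sort (m<n⇒m%n≡m (s<s p<q)) (n%n≡0 n)) (sort-comm (suc p) 0)))
  ... | no ne = trans (rot1-step p q ne)
    (sym (trans (cong₂ sort (m<n⇒m%n≡m (≤-<-trans p<q q<n)) (m<n⇒m%n≡m (≤∧≢⇒< q<n ne))) (sort-≤ (s≤s (<⇒≤ p<q)))))

  -- Equal residues have to be excluded: `rot1` sends the degenerate pair at vertex `n - 1` to
  -- `(0 , n)` instead of `(0 , 0)`.
  rot1-chord : ∀ {x y} → x % n ≢ y % n → rot1 n (chord (x , y)) ≡ chord (suc x , suc y)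
  rot1-chord {x} {y} ne with <-cmp (x % n) (y % n)
  ... | tri< lt _ _ = trans (cong (rot1 n) (sort-≤ (<⇒≤ lt)))
    (trans (rot1-sort lt (m%n<n y n)) (cong₂ sort (sym (suc-% x)) (sym (suc-% y))))
  ... | tri≈ _ eq _ = ⊥-elim (ne eq)
  ... | tri> _ _ gt = trans (cong (rot1 n) (trans (sort-comm (x % n) (y % n)) (sort-≤ (<⇒≤ gt))))
    (trans (rot1-sort gt (m%n<n x n)) (trans (cong₂ sort (sym (suc-% y)) (sym (suc-% x))) (sort-comm (suc y % n) (suc x % n))))

  rot-chord : ∀ r {x y} → x < y → y < n + x → rot n r (chord (x , y)) ≡ chord (shift r (x , y))
  rot-chord zero    _ _ = refl
  rot-chord (suc r) {x} {y} x<y y<n+x = trans (cong (rot1 n) (rot-chord r x<y y<n+x))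
    (rot1-chord (%-window-≢ (+-monoʳ-< r x<y) (subst (r + y <_) (lem r) (+-monoʳ-< r y<n+x))))
    where
    lem : ∀ r → r + (n + x) ≡ n + (r + x)
    lem r = trans (sym (+-assoc r n x)) (trans (cong (_+ x) (+-comm r n)) (+-assoc n r x))

  window-≤ : ∀ {r c x} → r ≤ c → c ≤ n + r → r ≤ x → x ≤ n + r → c % n ≡ x % n →
             c ≡ x ⊎ (c ≡ r × x ≡ n + r) ⊎ (x ≡ r × c ≡ n + r)
  window-≤ {r} {c} {x} r≤c c≤ r≤x x≤ e with ≤-total c x
  ... | inj₁ c≤x with %-window c≤x (≤-trans x≤ (+-monoʳ-≤ n r≤c)) e
  ...   | inj₁ eq   = inj₁ eq
  ...   | inj₂ refl = let eq = ≤-antisym (+-cancelˡ-≤ n c r x≤) r≤c in inj₂ (inj₁ (eq , cong (n +_) eq))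
  window-≤ {r} {c} {x} r≤c c≤ r≤x x≤ e | inj₂ x≤c with %-window x≤c (≤-trans c≤ (+-monoʳ-≤ n r≤x)) (sym e)
  ...   | inj₁ eq   = inj₁ (sym eq)
  ...   | inj₂ refl = let eq = ≤-antisym (+-cancelˡ-≤ n x r c≤) r≤x in inj₂ (inj₂ (eq , cong (n +_) eq))

  -- Chords are unordered, and `r` and `n + r` are one vertex. Hence an interval touching one end of
  -- the window `[r, n + r]` has the same chord as the complementary interval at the other end; this
  -- is the only ambiguity.
  data SameChord (r : ℕ) : ℕ → ℕ → ℕ → ℕ → Set where
    same  : ∀ {c d} → SameChord r c d c d
    wrapˡ : ∀ {d} → SameChord r r d d (n + r)
    wrapʳ : ∀ {c} → SameChord r c (n + r) r c

  chord-window : ∀ r {c d x y} → r ≤ c → c < d → d ≤ n + r → r ≤ x → x < y → y ≤ n + r →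
                 chord (c , d) ≡ chord (x , y) → SameChord r c d x y
  chord-window r r≤c c<d d≤ r≤x x<y y≤ e with sort-injective e
  ... | inj₁ (e₁ , e₂)
    with window-≤ r≤c (<⇒≤ (<-≤-trans c<d d≤)) r≤x (<⇒≤ (<-≤-trans x<y y≤)) e₁
       | window-≤ (<⇒≤ (≤-<-trans r≤c c<d)) d≤ (<⇒≤ (≤-<-trans r≤x x<y)) y≤ e₂
  ...   | inj₁ refl             | inj₁ refl             = same
  ...   | inj₂ (inj₁ (_ , refl)) | _                    = ⊥-elim (<⇒≱ x<y y≤)
  ...   | inj₂ (inj₂ (_ , refl)) | _                    = ⊥-elim (<⇒≱ c<d d≤)
  ...   | inj₁ _                | inj₂ (inj₁ (refl , _)) = ⊥-elim (<⇒≱ c<d r≤c)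
  ...   | inj₁ _                | inj₂ (inj₂ (refl , _)) = ⊥-elim (<⇒≱ x<y r≤x)
  chord-window r r≤c c<d d≤ r≤x x<y y≤ e | inj₂ (e₁ , e₂)
    with window-≤ r≤c (<⇒≤ (<-≤-trans c<d d≤)) (<⇒≤ (≤-<-trans r≤x x<y)) y≤ e₁
       | window-≤ (<⇒≤ (≤-<-trans r≤c c<d)) d≤ r≤x (<⇒≤ (<-≤-trans x<y y≤)) e₂
  ...   | inj₁ refl                 | inj₁ refl                 = ⊥-elim (<-asym c<d x<y)
  ...   | inj₁ refl                 | inj₂ (inj₂ (refl , refl)) = wrapʳ
  ...   | inj₂ (inj₁ (refl , refl)) | inj₁ refl                 = wrapˡ
  -- Both intervals are the whole window from `r` to `n + r`.
  ...   | inj₂ (inj₁ (refl , refl)) | inj₂ (inj₂ (refl , refl)) = same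
  ...   | inj₂ (inj₂ (_ , refl))    | _                         = ⊥-elim (<⇒≱ c<d d≤)
  ...   | _                         | inj₂ (inj₁ (refl , _))    = ⊥-elim (<⇒≱ c<d r≤c)

-- Chords of a forest

-- The chords cut off by the subtrees of t when its leaves are the sides of the
-- path a, a + 1, …, a + leaves t.
chords : ℕ → Tree → List (ℕ × ℕ)
chords a leaf       = []
chords a (node l r) = (a , a + (leaves l + leaves r)) ∷ chords a l ++ chords (a + leaves l) r

chords* : ∀ {s} → ℕ → Vec Tree s → List (ℕ × ℕ)
chords* a []       = []
chords* a (t ∷ ts) = chords a t ++ chords* (a + leaves t) ts

chords-shift : ∀ k a t → chords (k + a) t ≡ map (shift k) (chords a t)
chords-shift k a leaf       = refl
chords-shift k a (node l r) = cong₂ _∷_ (cong (k + a ,_) (+-assoc k a _)) (trans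
  (cong₂ _++_ (chords-shift k a l)
    (trans (cong (λ z → chords z r) (+-assoc k a (leaves l))) (chords-shift k (a + leaves l) r)))
  (sym (map-++ (shift k) (chords a l) (chords (a + leaves l) r))))

chords*-shift : ∀ {s} k a (ts : Vec Tree s) → chords* (k + a) ts ≡ map (shift k) (chords* a ts)
chords*-shift k a []       = refl
chords*-shift k a (t ∷ ts) = trans
  (cong₂ _++_ (chords-shift k a t)
    (trans (cong (λ z → chords* z ts) (+-assoc k a (leaves t))) (chords*-shift k (a + leaves t) ts)))
  (sym (map-++ (shift k) (chords a t) (chords* (a + leaves t) ts)))

chords*-∷ʳ : ∀ {s} a (ts : Vec Tree s) t → chords* a (ts ∷ʳ t) ≡ chords* a ts ++ chords (a + leaves* ts) t
chords*-∷ʳ a []       t = trans (++-identityʳ (chords a t)) (cong (λ z → chords z t) (sym (+-identityʳ a)))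
chords*-∷ʳ a (u ∷ ts) t = trans
  (cong (chords a u ++_) (trans (chords*-∷ʳ (a + leaves u) ts t)
    (cong (λ z → chords* (a + leaves u) ts ++ chords z t) (+-assoc a (leaves u) (leaves* ts)))))
  (sym (++-assoc (chords a u) (chords* (a + leaves u) ts) _))

leaves*-∷ʳ : ∀ {s} (ts : Vec Tree s) t → leaves* (ts ∷ʳ t) ≡ leaves* ts + leaves t
leaves*-∷ʳ []       t = +-identityʳ (leaves t)
leaves*-∷ʳ (u ∷ ts) t = trans (cong (leaves u +_) (leaves*-∷ʳ ts t)) (sym (+-assoc (leaves u) (leaves* ts) (leaves t)))

a<a+leaves : ∀ a t → a < a + leaves t
a<a+leaves a t = m<m+n a (leaves>0 t)

data NodeChord (a : ℕ) (l r : Tree) : ℕ → ℕ → Set where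
  root  : NodeChord a l r a (a + (leaves l + leaves r))
  left  : ∀ {x y} → (x , y) ∈ chords a l → NodeChord a l r x y
  right : ∀ {x y} → (x , y) ∈ chords (a + leaves l) r → NodeChord a l r x y

node-chord : ∀ {a l r x y} → (x , y) ∈ chords a (node l r) → NodeChord a l r x y
node-chord (here refl) = root
node-chord {a} {l} (there p) = [ left , right ]′ (∈-++⁻ (chords a l) p)

∈-left : ∀ {a l r p} → p ∈ chords a l → p ∈ chords a (node l r)
∈-left p = there (∈-++⁺ˡ p)

∈-right : ∀ {a l r p} → p ∈ chords (a + leaves l) r → p ∈ chords a (node l r)
∈-right {a} {l} p = there (∈-++⁺ʳ (chords a l) p)

chords-bounds : ∀ a t {x y} → (x , y) ∈ chords a t → a ≤ x × 2 + x ≤ y × y ≤ a + leaves t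
chords-bounds a (node l r) p with node-chord {a} {l} {r} p
... | root = ≤-refl , ≤-trans (≤-reflexive (+-comm 2 a)) (+-monoʳ-≤ a (+-mono-≤ (leaves>0 l) (leaves>0 r))) , ≤-refl
... | left q = let u , v , w = chords-bounds a l q in u , v , ≤-trans w (+-monoʳ-≤ a (m≤m+n (leaves l) (leaves r)))
... | right q = let u , v , w = chords-bounds (a + leaves l) r q in
  ≤-trans (m≤m+n a (leaves l)) u , v , ≤-trans w (≤-reflexive (+-assoc a (leaves l) (leaves r)))

chords-start : ∀ {a} t {x y} → (x , y) ∈ chords a t → a ≤ x
chords-start t p = proj₁ (chords-bounds _ t p)

chords-< : ∀ {a} t {x y} → (x , y) ∈ chords a t → x < y
chords-< t p = <⇒≤ (proj₁ (proj₂ (chords-bounds _ t p)))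

chords-end : ∀ {a} t {x y} → (x , y) ∈ chords a t → y ≤ a + leaves t
chords-end t p = proj₂ (proj₂ (chords-bounds _ t p))

root∈ : ∀ a t → 1 < leaves t → (a , a + leaves t) ∈ chords a t
root∈ a leaf       (s≤s ())
root∈ a (node l r) _ = here refl

-- The position of the root split is forced. If `l` is not a leaf, its root chord starts at `a` and
-- is shorter than the whole, so it lies in `l′`; the root chord of `r` ends at the far end, so it
-- lies in `r′`. This bounds `leaves l` from both sides, and a leaf meets its bound trivially.
chords-injective : ∀ a u t → leaves u ≡ leaves t → (∀ {p} → p ∈ chords a u → p ∈ chords a t) → u ≡ t
chords-injective a leaf leaf _ _ = refl
chords-injective a leaf (node l r) e _ = ⊥-elim (<-irrefl e (+-mono-≤ (leaves>0 l) (leaves>0 r)))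
chords-injective a (node l r) leaf e _ = ⊥-elim (<-irrefl (sym e) (+-mono-≤ (leaves>0 l) (leaves>0 r)))
chords-injective a (node l r) (node l′ r′) e sub = cong₂ node
  (chords-injective a l l′ el subˡ)
  (chords-injective (a + leaves l) r r′ er subʳ)
  where
  l≤l′ : leaves l ≤ leaves l′
  l≤l′ with 1 <? leaves l
  ... | no 1≮ = ≤-trans (≮⇒≥ 1≮) (leaves>0 l′)
  ... | yes 1< = case (node-chord (sub (∈-left {a} {l} {r} (root∈ a l 1<)))) refl
    where
    case : ∀ {y} → NodeChord a l′ r′ a y → y ≡ a + leaves l → leaves l ≤ leaves l′
    case root eq = ⊥-elim (<-irrefl (sym (+-cancelˡ-≡ a _ _ (trans (cong (a +_) e) eq))) (m<m+n (leaves l) (leaves>0 r)))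
    case (left p) refl = +-cancelˡ-≤ a _ _ (chords-end l′ p)
    case (right p) _ = ⊥-elim (<⇒≱ (a<a+leaves a l′) (chords-start r′ p))

  l′≤l : leaves l′ ≤ leaves l
  l′≤l with 1 <? leaves r
  ... | no 1≮ = +-cancelʳ-≤ (leaves r) _ _ (≤-trans (+-monoʳ-≤ (leaves l′) (≤-trans (≮⇒≥ 1≮) (leaves>0 r′))) (≤-reflexive (sym e)))
  ... | yes 1< = case (node-chord (sub (∈-right {a} {l} {r} (root∈ (a + leaves l) r 1<)))) refl (trans (+-assoc a (leaves l) (leaves r)) (cong (a +_) e))
    where
    case : ∀ {x y} → NodeChord a l′ r′ x y → x ≡ a + leaves l → y ≡ a + (leaves l′ + leaves r′) → leaves l′ ≤ leaves l
    case root eq _ = ⊥-elim (<-irrefl eq (a<a+leaves a l))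
    case (left p) _ refl = ⊥-elim (<⇒≱ (+-monoʳ-< a (m<m+n (leaves l′) (leaves>0 r′))) (chords-end l′ p))
    case (right p) refl _ = +-cancelˡ-≤ a _ _ (chords-start r′ p)

  el : leaves l ≡ leaves l′
  el = ≤-antisym l≤l′ l′≤l

  er : leaves r ≡ leaves r′
  er = +-cancelˡ-≡ (leaves l′) _ _ (trans (cong (_+ leaves r) (sym el)) e)

  subˡ : ∀ {p} → p ∈ chords a l → p ∈ chords a l′
  subˡ {x , y} p with node-chord {a} {l′} {r′} (sub (∈-left {a} {l} {r} p))
  ... | root = ⊥-elim (<⇒≱ (+-monoʳ-< a (m<m+n (leaves l′) (leaves>0 r′))) (≤-trans (chords-end l p) (+-monoʳ-≤ a l≤l′)))
  ... | left q = q
  ... | right q = ⊥-elim (<⇒≱ (chords-< l p) (≤-trans (chords-end l p) (≤-trans (+-monoʳ-≤ a l≤l′) (chords-start r′ q))))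

  subʳ : ∀ {p} → p ∈ chords (a + leaves l) r → p ∈ chords (a + leaves l) r′
  subʳ {x , y} p with node-chord {a} {l′} {r′} (sub (∈-right {a} {l} {r} p))
  ... | root = ⊥-elim (<⇒≱ (a<a+leaves a l) (chords-start r p))
  ... | left q = ⊥-elim (<⇒≱ (chords-< l′ q) (≤-trans (chords-end l′ q) (≤-trans (+-monoʳ-≤ a l′≤l) (chords-start r p))))
  ... | right q = subst (λ z → (x , y) ∈ chords (a + z) r′) (sym el) q

-- A quadrilateral b₀ < b₁ < b₂ < b₃ that no chord of t cuts does not fit under the
-- path of t: the triangle of t that first separates b₀ from b₃ would have its apex
-- both in [b₀, b₁] and in [b₂, b₃].
no-quadrilateral : ∀ a t {b₀ b₁ b₂ b₃} → b₀ < b₁ → b₁ < b₂ → b₂ < b₃ → a ≤ b₀ → b₃ ≤ a + leaves t →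
  (∀ {c d} → (c , d) ∈ chords a t → c ≤ b₀ → b₀ < d → d < b₃ → d ≤ b₁) →
  (∀ {c d} → (c , d) ∈ chords a t → b₀ < c → c < b₃ → b₃ ≤ d → b₂ ≤ c) → ⊥
no-quadrilateral a leaf {b₀} b₀<b₁ b₁<b₂ b₂<b₃ a≤b₀ b₃≤ _ _ =
  <⇒≱ (≤-<-trans (≤-trans (s≤s a≤b₀) b₀<b₁) (<-trans b₁<b₂ b₂<b₃)) (≤-trans b₃≤ (≤-reflexive (+-comm a 1)))
no-quadrilateral a (node l r) {b₀} {b₁} {b₂} {b₃} b₀<b₁ b₁<b₂ b₂<b₃ a≤b₀ b₃≤ lo hi
  with b₃ ≤? a + leaves l | a + leaves l ≤? b₀
... | yes b₃≤m | _ = no-quadrilateral a l b₀<b₁ b₁<b₂ b₂<b₃ a≤b₀ b₃≤m (lo ∘ ∈-left {a} {l} {r}) (hi ∘ ∈-left {a} {l} {r})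
... | no _ | yes m≤b₀ = no-quadrilateral (a + leaves l) r b₀<b₁ b₁<b₂ b₂<b₃ m≤b₀
  (≤-trans b₃≤ (≤-reflexive (sym (+-assoc a (leaves l) (leaves r))))) (lo ∘ ∈-right {a} {l} {r}) (hi ∘ ∈-right {a} {l} {r})
... | no b₃≰m | no m≰b₀ = <⇒≱ b₁<b₂ (≤-trans b₂≤m m≤b₁)
  where
  m = a + leaves l
  m≤b₁ : m ≤ b₁
  m≤b₁ with 1 <? leaves l
  ... | yes 1< = lo (∈-left {a} {l} {r} (root∈ a l 1<)) a≤b₀ (≰⇒> m≰b₀) (≰⇒> b₃≰m)
  ... | no 1≮ = ≤-trans (+-mono-≤ a≤b₀ (≮⇒≥ 1≮)) (≤-trans (≤-reflexive (+-comm b₀ 1)) b₀<b₁)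
  b₃≤m+r : b₃ ≤ m + leaves r
  b₃≤m+r = ≤-trans b₃≤ (≤-reflexive (sym (+-assoc a (leaves l) (leaves r))))
  b₂≤m : b₂ ≤ m
  b₂≤m with 1 <? leaves r
  ... | yes 1< = hi (∈-right {a} {l} {r} (root∈ m r 1<)) (≰⇒> m≰b₀) (≰⇒> b₃≰m) b₃≤m+r
  ... | no 1≮ = ≤-pred (≤-trans b₂<b₃ (≤-trans b₃≤m+r (≤-trans (+-monoʳ-≤ m (≮⇒≥ 1≮)) (≤-reflexive (+-comm m 1)))))

-- Singles out the tree of a forest that contains a given chord, so that `no-quadrilateral`, a
-- statement about one tree, applies to forests.
record Subtree {s} (a : ℕ) (ts : Vec Tree s) (p : ℕ × ℕ) : Set where
  field
    start   : ℕ
    tree    : Tree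
    member  : p ∈ chords start tree
    include : ∀ {q} → q ∈ chords start tree → q ∈ chords* a ts
    a≤start : a ≤ start
    end≤    : start + leaves tree ≤ a + leaves* ts

subtree : ∀ {s} a (ts : Vec Tree s) {p} → p ∈ chords* a ts → Subtree a ts p
subtree a (t ∷ ts) p with ∈-++⁻ (chords a t) p
... | inj₁ q = record
  { start = a ; tree = t ; member = q ; include = ∈-++⁺ˡ ; a≤start = ≤-refl
  ; end≤ = +-monoʳ-≤ a (m≤m+n (leaves t) (leaves* ts)) }
... | inj₂ q = record
  { start = S.start ; tree = S.tree ; member = S.member ; include = ∈-++⁺ʳ (chords a t) ∘ S.include
  ; a≤start = ≤-trans (m≤m+n a (leaves t)) S.a≤start
  ; end≤ = ≤-trans S.end≤ (≤-reflexive (+-assoc a (leaves t) (leaves* ts))) }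
  where module S = Subtree (subtree (a + leaves t) ts q)

chords*-bounds : ∀ {s} a (ts : Vec Tree s) {x y} → (x , y) ∈ chords* a ts → a ≤ x × 2 + x ≤ y × y ≤ a + leaves* ts
chords*-bounds a ts p =
  let a≤x , x<y , y≤ = chords-bounds S.start S.tree S.member in ≤-trans S.a≤start a≤x , x<y , ≤-trans y≤ S.end≤
  where module S = Subtree (subtree a ts p)

-- Forests around a polygon and the uniqueness of the quadruple

rotate : ∀ {s} → Vec Tree (suc s) → Vec Tree (suc s)
rotate (t ∷ ts) = ts ∷ʳ t

leaves*-rotate : ∀ {s} (ts : Vec Tree (suc s)) → leaves* (rotate ts) ≡ leaves* ts
leaves*-rotate (t ∷ ts) = trans (leaves*-∷ʳ ts t) (+-comm (leaves* ts) (leaves t))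

infix 4 _≃_
_≃_ : {A : Set} → List A → List A → Set
xs ≃ ys = (∀ {x} → x ∈ xs → x ∈ ys) × (∀ {x} → x ∈ ys → x ∈ xs)

≃-sym : {A : Set} {xs ys : List A} → xs ≃ ys → ys ≃ xs
≃-sym (f , g) = g , f

≃-trans : {A : Set} {xs ys zs : List A} → xs ≃ ys → ys ≃ zs → xs ≃ zs
≃-trans (f , g) (h , k) = h ∘ f , g ∘ k

↭⇒≃ : {A : Set} {xs ys : List A} → xs ↭ ys → xs ≃ ys
↭⇒≃ p = Permₚ.∈-resp-↭ p , Permₚ.∈-resp-↭ (↭-sym p)

module Polygon (n : ℕ) .{{nz : NonZero n}} where
  open Cyclic n

  polygon : ∀ {s} → ℕ → Vec Tree s → List (ℕ × ℕ)
  polygon r ts = map chord (chords* r ts)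

  -- When the base point moves past the first tree and that tree goes to the end, it comes to stand
  -- at `n + r`, one period later, where it has the same chords.
  polygon-rotate : ∀ {s} r t (ts : Vec Tree s) → leaves* (t ∷ ts) ≡ n →
                   polygon (r + leaves t) (ts ∷ʳ t) ↭ polygon r (t ∷ ts)
  polygon-rotate r t ts total = ↭-trans (↭-reflexive unroll)
    (↭-trans (Permₚ.++-comm (map chord (chords* p ts)) (map chord (chords r t)))
      (↭-reflexive (sym (map-++ chord (chords r t) (chords* p ts)))))
    where
    p = r + leaves t
    end : p + leaves* ts ≡ n + r
    end = trans (+-assoc r (leaves t) (leaves* ts)) (trans (cong (r +_) total) (+-comm r n))
    wrap : map chord (chords (n + r) t) ≡ map chord (chords r t)
    wrap = trans (cong (map chord) (chords-shift n r t))
      (trans (sym (map-∘ (chords r t))) (map-cong chord-period₁ (chords r t)))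
    unroll : polygon p (ts ∷ʳ t) ≡ map chord (chords* p ts) ++ map chord (chords r t)
    unroll = begin
      map chord (chords* p (ts ∷ʳ t))
        ≡⟨ cong (map chord) (chords*-∷ʳ p ts t) ⟩
      map chord (chords* p ts ++ chords (p + leaves* ts) t)
        ≡⟨ map-++ chord (chords* p ts) _ ⟩
      map chord (chords* p ts) ++ map chord (chords (p + leaves* ts) t)
        ≡⟨ cong (λ z → map chord (chords* p ts) ++ map chord (chords z t)) end ⟩
      map chord (chords* p ts) ++ map chord (chords (n + r) t)
        ≡⟨ cong (map chord (chords* p ts) ++_) wrap ⟩
      map chord (chords* p ts) ++ map chord (chords r t) ∎

  -- The wrap cases record that the complementary interval is the one listed, as in `SameChord`.
  data Located {s} (r : ℕ) (ts : Vec Tree s) (c d : ℕ) : Set where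
    direct : (c , d) ∈ chords* r ts → Located r ts c d
    wrapˡ  : c ≡ r → (d , n + r) ∈ chords* r ts → Located r ts c d
    wrapʳ  : d ≡ n + r → (r , c) ∈ chords* r ts → Located r ts c d

  locate : ∀ {s} {r} {ts : Vec Tree s} {c d} → leaves* ts ≡ n → chord (c , d) ∈ polygon r ts →
           r ≤ c → c < d → d ≤ n + r → Located r ts c d
  locate {r = r} {ts} {c} {d} total p r≤c c<d d≤ with ∈-map⁻ chord p
  ... | (x , y) , q , e = case q
          (chord-window r r≤c c<d d≤ (proj₁ bounds) (<⇒≤ (proj₁ (proj₂ bounds)))
            (≤-trans (proj₂ (proj₂ bounds)) (≤-reflexive (trans (cong (r +_) total) (+-comm r n)))) e)
    where
    bounds = chords*-bounds r ts q
    case : ∀ {c d x y} → (x , y) ∈ chords* r ts → SameChord r c d x y → Located r ts c d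
    case q same  = direct q
    case q wrapˡ = wrapˡ refl q
    case q wrapʳ = wrapʳ refl q

  module Quadrilateral (r : ℕ) (t₁ t₂ t₃ t₄ : Tree) where
    ts : Vec Tree 4
    ts = t₁ ∷ t₂ ∷ t₃ ∷ t₄ ∷ []
    p₁ = r + leaves t₁
    p₂ = p₁ + leaves t₂
    p₃ = p₂ + leaves t₃
    p₄ = p₃ + leaves t₄

    r<p₁ : r < p₁
    r<p₁ = a<a+leaves r t₁
    p₁<p₂ : p₁ < p₂
    p₁<p₂ = a<a+leaves p₁ t₂
    p₂<p₃ : p₂ < p₃
    p₂<p₃ = a<a+leaves p₂ t₃
    p₃<p₄ : p₃ < p₄
    p₃<p₄ = a<a+leaves p₃ t₄
    p₁<p₃ : p₁ < p₃
    p₁<p₃ = <-trans p₁<p₂ p₂<p₃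

    -- Membership is kept for the first tree only, as that is the tree being recovered; for the
    -- other three arcs the position is what matters.
    data Arc (x y : ℕ) : Set where
      arc₁ : (x , y) ∈ chords r t₁ → y ≤ p₁ → Arc x y
      arc₂ : p₁ ≤ x → y ≤ p₂ → Arc x y
      arc₃ : p₂ ≤ x → y ≤ p₃ → Arc x y
      arc₄ : p₃ ≤ x → y ≤ p₄ → Arc x y

    arc : ∀ {x y} → (x , y) ∈ chords* r ts → Arc x y
    arc p with ∈-++⁻ (chords r t₁) p
    ... | inj₁ q = arc₁ q (chords-end t₁ q)
    ... | inj₂ p with ∈-++⁻ (chords p₁ t₂) p
    ...   | inj₁ q = arc₂ (chords-start t₂ q) (chords-end t₂ q)
    ...   | inj₂ p with ∈-++⁻ (chords p₂ t₃) p
    ...     | inj₁ q = arc₃ (chords-start t₃ q) (chords-end t₃ q)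
    ...     | inj₂ p with ∈-++⁻ (chords p₃ t₄) p
    ...       | inj₁ q = arc₄ (chords-start t₄ q) (chords-end t₄ q)

    arc-start : ∀ {x y} → Arc x y → x < p₁ → y ≤ p₁
    arc-start (arc₁ _ y≤)  _    = y≤
    arc-start (arc₂ p≤x _) x<p₁ = ⊥-elim (<⇒≱ x<p₁ p≤x)
    arc-start (arc₃ p≤x _) x<p₁ = ⊥-elim (<⇒≱ x<p₁ (≤-trans (<⇒≤ p₁<p₂) p≤x))
    arc-start (arc₄ p≤x _) x<p₁ = ⊥-elim (<⇒≱ x<p₁ (≤-trans (<⇒≤ p₁<p₃) p≤x))

    arc-end : ∀ {x y} → Arc x y → p₃ < y → p₃ ≤ x
    arc-end (arc₁ _ y≤)  p₃<y = ⊥-elim (<⇒≱ p₃<y (≤-trans y≤ (<⇒≤ p₁<p₃)))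
    arc-end (arc₂ _ y≤)  p₃<y = ⊥-elim (<⇒≱ p₃<y (≤-trans y≤ (<⇒≤ p₂<p₃)))
    arc-end (arc₃ _ y≤)  p₃<y = ⊥-elim (<⇒≱ p₃<y y≤)
    arc-end (arc₄ p≤x _) _    = p≤x

    arc-₂ : ∀ {x y} → Arc x y → x ≤ p₁ → p₁ < y → y ≤ p₂
    arc-₂ (arc₁ _ y≤)  _    p₁<y = ⊥-elim (<⇒≱ p₁<y y≤)
    arc-₂ (arc₂ _ y≤)  _    _    = y≤
    arc-₂ (arc₃ p≤x _) x≤p₁ _    = ⊥-elim (<⇒≱ p₁<p₂ (≤-trans p≤x x≤p₁))
    arc-₂ (arc₄ p≤x _) x≤p₁ _    = ⊥-elim (<⇒≱ p₁<p₃ (≤-trans p≤x x≤p₁))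

    arc-₃ : ∀ {x y} → Arc x y → p₃ ≤ y → x < p₃ → p₂ ≤ x
    arc-₃ (arc₁ _ y≤)  p₃≤y _ = ⊥-elim (<⇒≱ p₁<p₃ (≤-trans p₃≤y y≤))
    arc-₃ (arc₂ _ y≤)  p₃≤y _ = ⊥-elim (<⇒≱ p₂<p₃ (≤-trans p₃≤y y≤))
    arc-₃ (arc₃ p≤x _) _    _ = p≤x
    arc-₃ (arc₄ p≤x _) _ x<p₃ = ⊥-elim (<⇒≱ x<p₃ p≤x)

    -- The bounds come from the complementary interval: one that ends at `n + r` belongs to the
    -- fourth tree and starts at `p₃` or later, one that starts at `r` belongs to the first tree and
    -- ends by `p₁`.
    data Location (c d : ℕ) : Set where
      within : Arc c d → Location c d
      wrapˡ  : c ≡ r → p₃ ≤ d → Location c d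
      wrapʳ  : d ≡ n + r → c ≤ p₁ → Location c d

    module _ (total : leaves* ts ≡ n) where

      p₄≡ : p₄ ≡ n + r
      p₄≡ = trans (trans (cong (_+ leaves t₄) (cong (_+ leaves t₃) (+-assoc r (leaves t₁) (leaves t₂))))
        (lem r (leaves t₁) (leaves t₂) (leaves t₃) (leaves t₄))) (trans (cong (r +_) total) (+-comm r n))
        where
        lem : ∀ r a b c d → r + (a + b) + c + d ≡ r + (a + (b + (c + (d + 0))))
        lem = solve-∀

      p₃<n+r : p₃ < n + r
      p₃<n+r = <-≤-trans p₃<p₄ (≤-reflexive p₄≡)

      p₁<n+r : p₁ < n + r
      p₁<n+r = <-trans p₁<p₃ p₃<n+r

      location : ∀ {c d} → chord (c , d) ∈ polygon r ts → r ≤ c → c < d → d ≤ n + r → Location c d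
      location p r≤c c<d d≤ with locate {ts = ts} total p r≤c c<d d≤
      ... | direct q  = within (arc q)
      ... | wrapˡ e q = wrapˡ e (arc-end (arc q) p₃<n+r)
      ... | wrapʳ e q = wrapʳ e (arc-start (arc q) r<p₁)

  module _ (r : ℕ) (t₁ t₂ t₃ t₄ u₁ u₂ u₃ u₄ : Tree) where
    private
      module Q = Quadrilateral r t₁ t₂ t₃ t₄
      ts : Vec Tree 4
      ts = t₁ ∷ t₂ ∷ t₃ ∷ t₄ ∷ []
      us : Vec Tree 4
      us = u₁ ∷ u₂ ∷ u₃ ∷ u₄ ∷ []

    module _ (totalₜ : leaves* ts ≡ n) (totalᵤ : leaves* us ≡ n)
             (sub : ∀ {z} → z ∈ polygon r us → z ∈ polygon r ts) where
      private
        module Q′ = Quadrilateral r u₁ u₂ u₃ u₄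

        sub₁ : ∀ {c d} → (c , d) ∈ chords r u₁ → Q.Location c d
        sub₁ {c} {d} p = Q.location totalₜ {c} {d} (sub (∈-map⁺ chord (∈-++⁺ˡ p))) (chords-start u₁ p) (chords-< u₁ p)
          (≤-trans (chords-end u₁ p) (<⇒≤ (Q′.p₁<n+r totalᵤ)))

      -- If `u₁` were longer, its root chord would start at `r` and pass `p₁`; as a chord of the
      -- other polygon it would have to reach `p₃`. Then the quadrilateral `r`, `p₁`, `p₂`, `p₃`
      -- would fit under `u₁` without being cut.
      head-≤ : leaves u₁ ≤ leaves t₁
      head-≤ = ≮⇒≥ λ t₁<u₁ →
        let p₁<end = +-monoʳ-< r t₁<u₁ in
        no-quadrilateral r u₁ Q.r<p₁ Q.p₁<p₂ Q.p₂<p₃ ≤-refl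
          (reach p₁<end (sub₁ (root∈ r u₁ (≤-<-trans (leaves>0 t₁) t₁<u₁))))
          (λ p c≤r r<d d<p₃ → lo (sub₁ p) (≤-antisym c≤r (chords-start u₁ p)) d<p₃)
          (λ p r<c c<p₃ p₃≤d → hi (sub₁ p) (chords-end u₁ p) r<c c<p₃ p₃≤d)
        where
        reach : ∀ {d} → Q.p₁ < d → Q.Location r d → Q.p₃ ≤ d
        reach p₁<d (Q.within a)   = ⊥-elim (<⇒≱ p₁<d (Q.arc-start a Q.r<p₁))
        reach p₁<d (Q.wrapˡ _ p₃≤) = p₃≤
        reach p₁<d (Q.wrapʳ refl _) = <⇒≤ (Q.p₃<n+r totalₜ)
        lo : ∀ {c d} → Q.Location c d → c ≡ r → d < Q.p₃ → d ≤ Q.p₁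
        lo (Q.within a)    refl _ = Q.arc-start a Q.r<p₁
        lo (Q.wrapˡ _ p₃≤)  _ d<p₃ = ⊥-elim (<⇒≱ d<p₃ p₃≤)
        lo (Q.wrapʳ refl _) _ d<p₃ = ⊥-elim (<-asym d<p₃ (Q.p₃<n+r totalₜ))
        hi : ∀ {c d} → Q.Location c d → d ≤ r + leaves u₁ → r < c → c < Q.p₃ → Q.p₃ ≤ d → Q.p₂ ≤ c
        hi (Q.within a)     _  _   c<p₃ p₃≤d = Q.arc-₃ a p₃≤d c<p₃
        hi (Q.wrapˡ refl _) _  r<r _    _    = ⊥-elim (<-irrefl refl r<r)
        hi (Q.wrapʳ refl _) d≤ _   _    _    = ⊥-elim (<⇒≱ (Q′.p₁<n+r totalᵤ) d≤)

      head-⊆ : leaves u₁ ≤ leaves t₁ → ∀ {p} → p ∈ chords r u₁ → p ∈ chords r t₁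
      head-⊆ u≤t {c , d} p =
        case (sub₁ p) (chords-< u₁ p) (≤-trans (chords-end u₁ p) (+-monoʳ-≤ r u≤t))
        where
        case : ∀ {c d} → Q.Location c d → c < d → d ≤ Q.p₁ → (c , d) ∈ chords r t₁
        case (Q.within (Q.arc₁ q _))   _   _  = q
        case (Q.within (Q.arc₂ p≤c _)) c<d d≤ = ⊥-elim (<⇒≱ c<d (≤-trans d≤ p≤c))
        case (Q.within (Q.arc₃ p≤c _)) c<d d≤ = ⊥-elim (<⇒≱ c<d (≤-trans d≤ (≤-trans (<⇒≤ Q.p₁<p₂) p≤c)))
        case (Q.within (Q.arc₄ p≤c _)) c<d d≤ = ⊥-elim (<⇒≱ c<d (≤-trans d≤ (≤-trans (<⇒≤ Q.p₁<p₃) p≤c)))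
        case (Q.wrapˡ _ p₃≤d)          _   d≤ = ⊥-elim (<⇒≱ Q.p₁<p₃ (≤-trans p₃≤d d≤))
        case (Q.wrapʳ refl _)          _   d≤ = ⊥-elim (<⇒≱ (Q.p₁<n+r totalₜ) d≤)

  head-≡ : ∀ r t₁ t₂ t₃ t₄ u₁ u₂ u₃ u₄ →
           leaves* (t₁ ∷ t₂ ∷ t₃ ∷ t₄ ∷ []) ≡ n → leaves* (u₁ ∷ u₂ ∷ u₃ ∷ u₄ ∷ []) ≡ n →
           polygon r (t₁ ∷ t₂ ∷ t₃ ∷ t₄ ∷ []) ≃ polygon r (u₁ ∷ u₂ ∷ u₃ ∷ u₄ ∷ []) → t₁ ≡ u₁
  head-≡ r t₁ t₂ t₃ t₄ u₁ u₂ u₃ u₄ totalₜ totalᵤ (f , g) =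
    chords-injective r t₁ u₁ (≤-antisym t≤u u≤t)
      (head-⊆ r u₁ u₂ u₃ u₄ t₁ t₂ t₃ t₄ totalᵤ totalₜ f t≤u)
    where
    t≤u = head-≤ r u₁ u₂ u₃ u₄ t₁ t₂ t₃ t₄ totalᵤ totalₜ f
    u≤t = head-≤ r t₁ t₂ t₃ t₄ u₁ u₂ u₃ u₄ totalₜ totalᵤ g

  rotate-≃ : ∀ {s} r {t u : Tree} (ts us : Vec Tree s) → leaves* (t ∷ ts) ≡ n → leaves* (u ∷ us) ≡ n → t ≡ u →
             polygon r (t ∷ ts) ≃ polygon r (u ∷ us) → polygon (r + leaves t) (ts ∷ʳ t) ≃ polygon (r + leaves t) (us ∷ʳ u)
  rotate-≃ r {t} ts us totalₜ totalᵤ refl eq = ≃-trans (↭⇒≃ (polygon-rotate r t ts totalₜ))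
    (≃-trans eq (≃-sym (↭⇒≃ (polygon-rotate r t us totalᵤ))))

  total-rotate : ∀ {s} (t : Tree) (ts : Vec Tree s) → leaves* (t ∷ ts) ≡ n → leaves* (ts ∷ʳ t) ≡ n
  total-rotate t ts total = trans (leaves*-rotate (t ∷ ts)) total

  -- `head-≡` only sees the tree at the base point. Once these agree, both quadruples rotate by the
  -- same number of leaves and keep a common base point, which exposes the next tree.
  polygon-injective : ∀ r (ts us : Vec Tree 4) → leaves* ts ≡ n → leaves* us ≡ n →
                      polygon r ts ≃ polygon r us → ts ≡ us
  polygon-injective r (t₁ ∷ t₂ ∷ t₃ ∷ t₄ ∷ []) (u₁ ∷ u₂ ∷ u₃ ∷ u₄ ∷ []) T₀ U₀ eq₀ =
    cong₂ _∷_ e₁ (cong₂ _∷_ e₂ (cong₂ _∷_ e₃ (cong (_∷ []) e₄)))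
    where
    e₁  = head-≡ r t₁ t₂ t₃ t₄ u₁ u₂ u₃ u₄ T₀ U₀ eq₀
    T₁  = total-rotate t₁ (t₂ ∷ t₃ ∷ t₄ ∷ []) T₀
    U₁  = total-rotate u₁ (u₂ ∷ u₃ ∷ u₄ ∷ []) U₀
    eq₁ = rotate-≃ r (t₂ ∷ t₃ ∷ t₄ ∷ []) (u₂ ∷ u₃ ∷ u₄ ∷ []) T₀ U₀ e₁ eq₀
    e₂  = head-≡ _ t₂ t₃ t₄ t₁ u₂ u₃ u₄ u₁ T₁ U₁ eq₁
    T₂  = total-rotate t₂ (t₃ ∷ t₄ ∷ t₁ ∷ []) T₁
    U₂  = total-rotate u₂ (u₃ ∷ u₄ ∷ u₁ ∷ []) U₁
    eq₂ = rotate-≃ _ (t₃ ∷ t₄ ∷ t₁ ∷ []) (u₃ ∷ u₄ ∷ u₁ ∷ []) T₁ U₁ e₂ eq₁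
    e₃  = head-≡ _ t₃ t₄ t₁ t₂ u₃ u₄ u₁ u₂ T₂ U₂ eq₂
    T₃  = total-rotate t₃ (t₄ ∷ t₁ ∷ t₂ ∷ []) T₂
    U₃  = total-rotate u₃ (u₄ ∷ u₁ ∷ u₂ ∷ []) U₂
    eq₃ = rotate-≃ _ (t₄ ∷ t₁ ∷ t₂ ∷ []) (u₄ ∷ u₁ ∷ u₂ ∷ []) T₂ U₂ e₃ eq₂
    e₄  = head-≡ _ t₄ t₁ t₂ t₃ u₄ u₁ u₂ u₃ T₃ U₃ eq₃

  -- If r < r′ < p₁, the side (p₁, n + r) of the first quadrilateral lies under one of
  -- the trees hanging on the second, which then contains the first quadrilateral.
  no-offset : ∀ r r′ t₁ t₂ t₃ t₄ {s} (us : Vec Tree s) →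
              leaves* (t₁ ∷ t₂ ∷ t₃ ∷ t₄ ∷ []) ≡ n → leaves* us ≡ n →
              polygon r (t₁ ∷ t₂ ∷ t₃ ∷ t₄ ∷ []) ≃ polygon r′ us → r < r′ → r′ < r + leaves t₁ → ⊥
  no-offset r r′ t₁ t₂ t₃ t₄ us T U (f , g) r<r′ r′<p₁ = go
    (locate U (f (subst (_∈ polygon r ts) (sym (chord-wrap Q.p₁ r)) (∈-map⁺ chord (∈-++⁺ˡ (root∈ r t₁ nonleaf)))))
      (<⇒≤ r′<p₁) (Q.p₁<n+r T) (+-monoʳ-≤ n (<⇒≤ r<r′)))
    where
    ts : Vec Tree 4
    ts = t₁ ∷ t₂ ∷ t₃ ∷ t₄ ∷ []
    module Q = Quadrilateral r t₁ t₂ t₃ t₄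
    nonleaf : 1 < leaves t₁
    nonleaf = +-cancelˡ-< r 1 (leaves t₁) (≤-<-trans (≤-trans (≤-reflexive (+-comm r 1)) r<r′) r′<p₁)

    module Inside {c d} (p : (c , d) ∈ chords* r′ us) where
      bounds = chords*-bounds r′ us p
      r′≤c = proj₁ bounds
      c<d = <⇒≤ (proj₁ (proj₂ bounds))
      d≤n+r′ : d ≤ n + r′
      d≤n+r′ = ≤-trans (proj₂ (proj₂ bounds)) (≤-reflexive (trans (cong (r′ +_) U) (+-comm r′ n)))
      r<c : r < c
      r<c = <-≤-trans r<r′ r′≤c

      in-ts : chord (c , d) ∈ polygon r ts
      in-ts = g (∈-map⁺ chord p)

      lo : c ≤ Q.p₁ → Q.p₁ < d → d < n + r → d ≤ Q.p₂
      lo c≤p₁ p₁<d d<n+r = case (Q.location T {c} {d} in-ts (<⇒≤ r<c) c<d (<⇒≤ d<n+r))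
        where
        case : Q.Location c d → d ≤ Q.p₂
        case (Q.within a)  = Q.arc-₂ a c≤p₁ p₁<d
        case (Q.wrapˡ e _) = ⊥-elim (<-irrefl (sym e) r<c)
        case (Q.wrapʳ e _) = ⊥-elim (<-irrefl e d<n+r)

      hi-= : Q.p₁ < c → n + r ≡ d → Q.p₃ ≤ c
      hi-= p₁<c e = case (Q.location T {c} {d} in-ts (<⇒≤ r<c) c<d (≤-reflexive (sym e)))
        where
        case : Q.Location c d → Q.p₃ ≤ c
        case (Q.within a)     = Q.arc-end a (subst (Q.p₃ <_) e (Q.p₃<n+r T))
        case (Q.wrapˡ e _)    = ⊥-elim (<-irrefl (sym e) r<c)
        case (Q.wrapʳ _ c≤p₁) = ⊥-elim (<⇒≱ p₁<c c≤p₁)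

      -- Past `n + r` the endpoint `d` is the vertex `d - n`, strictly between `r` and `p₁`. The
      -- chord from there to `c` would cross the side `(r, p₁)` of the quadrilateral.
      hi-< : Q.p₁ < c → c < n + r → n + r < d → ⊥
      hi-< p₁<c c<n+r n+r<d = crossing
        (Q.location T {d′} {c}
          (subst (_∈ polygon r ts) (trans (cong (λ z → chord (c , z)) (sym n+d′≡d)) (chord-wrap c d′)) in-ts)
          (<⇒≤ r<d′) (<-trans d′<p₁ p₁<c) (<⇒≤ c<n+r))
        where
        d′ = d ∸ n
        n+d′≡d : n + d′ ≡ d
        n+d′≡d = m+[n∸m]≡n (≤-trans (m≤m+n n r) (<⇒≤ n+r<d))
        r<d′ : r < d′
        r<d′ = +-cancelˡ-< n r d′ (<-≤-trans n+r<d (≤-reflexive (sym n+d′≡d)))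
        d′<p₁ : d′ < Q.p₁
        d′<p₁ = ≤-<-trans (+-cancelˡ-≤ n d′ r′ (≤-trans (≤-reflexive n+d′≡d) d≤n+r′)) r′<p₁
        crossing : Q.Location d′ c → ⊥
        crossing (Q.within a)    = <⇒≱ p₁<c (Q.arc-start a d′<p₁)
        crossing (Q.wrapˡ e _)   = <-irrefl (sym e) r<d′
        crossing (Q.wrapʳ e _)   = <-irrefl e c<n+r

      hi : Q.p₁ < c → c < n + r → n + r ≤ d → Q.p₃ ≤ c
      hi p₁<c c<n+r n+r≤d =
        [ (λ n+r<d → ⊥-elim (hi-< p₁<c c<n+r n+r<d)) , hi-= p₁<c ]′ (m≤n⇒m<n∨m≡n n+r≤d)

    go : Located r′ us Q.p₁ (n + r) → ⊥
    go (wrapˡ e _) = <-irrefl (sym e) r′<p₁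
    go (wrapʳ e _) = <-irrefl (+-cancelˡ-≡ n _ _ e) r<r′
    go (direct p) = no-quadrilateral S.start S.tree Q.p₁<p₂ Q.p₂<p₃ (Q.p₃<n+r T)
      (chords-start S.tree S.member) (chords-end S.tree S.member)
      (λ q → Inside.lo (S.include q)) (λ q → Inside.hi (S.include q))
      where module S = Subtree (subtree r′ us p)

-- The dissection built from four trees

_≟ᵗ_ : DecidableEquality Tree
leaf     ≟ᵗ leaf       = yes refl
leaf     ≟ᵗ node _ _   = no λ ()
node _ _ ≟ᵗ leaf       = no λ ()
node l r ≟ᵗ node l′ r′ with l ≟ᵗ l′ | r ≟ᵗ r′
... | yes refl | yes refl = yes refl
... | no ne    | _        = no λ { refl → ne refl }
... | _        | no ne    = no λ { refl → ne refl }

infix 4 _≟*_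
_≟*_ : DecidableEquality (Vec Tree 4)
_≟*_ = Vecₚ.≡-dec _≟ᵗ_

rotate⁴ : (ts : Vec Tree 4) → rotate (rotate (rotate (rotate ts))) ≡ ts
rotate⁴ (_ ∷ _ ∷ _ ∷ _ ∷ []) = refl

open Rotation _≟*_ rotate rotate⁴

-- The relation is directed because `chords` lists a tree in preorder: a later chord is never above
-- or to the left of an earlier one. The strictness in each constructor also gives distinctness.
data Laminar : ℕ × ℕ → ℕ × ℕ → Set where
  under  : ∀ {x y c d} → x ≤ c → d ≤ y → x < c ⊎ d < y → Laminar (x , y) (c , d)
  before : ∀ {x y c d} → x < y → y ≤ c → Laminar (x , y) (c , d)

Laminar⇒≢ : ∀ {p q} → Laminar p q → p ≢ q
Laminar⇒≢ (under _ _ (inj₁ x<c)) refl = <-irrefl refl x<c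
Laminar⇒≢ (under _ _ (inj₂ d<y)) refl = <-irrefl refl d<y
Laminar⇒≢ (before x<y y≤c)       refl = <⇒≱ x<y y≤c

chords-laminar : ∀ a t → AllPairs Laminar (chords a t)
chords-laminar a leaf       = []
chords-laminar a (node l r) =
  Allₚ.++⁺
    (All.tabulate λ {(x , y)} p → under (chords-start l p) (≤-trans (chords-end l p) (<⇒≤ m<e)) (inj₂ (≤-<-trans (chords-end l p) m<e)))
    (All.tabulate λ {(x , y)} p → under (≤-trans (<⇒≤ a<m) (chords-start r p)) (≤-trans (chords-end r p) (≤-reflexive (+-assoc a _ _)))
      (inj₁ (<-≤-trans a<m (chords-start r p))))
  ∷ AllPairsₚ.++⁺ (chords-laminar a l) (chords-laminar m r)
      (All.tabulate λ {(x , y)} p → All.tabulate λ {(c , d)} q → before (chords-< l p) (≤-trans (chords-end l p) (chords-start r q)))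
  where
  m = a + leaves l
  a<m : a < m
  a<m = a<a+leaves a l
  m<e : m < a + (leaves l + leaves r)
  m<e = +-monoʳ-< a (m<m+n (leaves l) (leaves>0 r))

chords*-laminar : ∀ {s} a (ts : Vec Tree s) → AllPairs Laminar (chords* a ts)
chords*-laminar a []       = []
chords*-laminar a (t ∷ ts) = AllPairsₚ.++⁺ (chords-laminar a t) (chords*-laminar (a + leaves t) ts)
  (All.tabulate λ {(x , y)} p → All.tabulate λ {(c , d)} q →
    before (chords-< t p) (≤-trans (chords-end t p) (proj₁ (chords*-bounds (a + leaves t) ts q))))

length-chords : ∀ a t → suc (length (chords a t)) ≡ leaves t
length-chords a leaf       = refl
length-chords a (node l r) = trans (cong (λ z → suc (suc z)) (length-++ (chords a l)))
  (trans (cong suc (sym (+-suc (length (chords a l)) _))) (cong₂ _+_ (length-chords a l) (length-chords (a + leaves l) r)))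

length-chords* : ∀ {s} a (ts : Vec Tree s) → s + length (chords* a ts) ≡ leaves* ts
length-chords* a []       = refl
length-chords* {suc s} a (t ∷ ts) = begin
  suc s + length (chords a t ++ chords* p ts)                ≡⟨ cong (suc s +_) (length-++ (chords a t)) ⟩
  suc s + (length (chords a t) + length (chords* p ts))      ≡⟨ lem s (length (chords a t)) _ ⟩
  suc (length (chords a t)) + (s + length (chords* p ts))    ≡⟨ cong₂ _+_ (length-chords a t) (length-chords* p ts) ⟩
  leaves t + leaves* ts                                      ∎
  where
  p = a + leaves t
  lem : ∀ s a b → suc s + (a + b) ≡ suc a + (s + b)
  lem = solve-∀

unique-map : ∀ {A B : Set} (f : A → B) xs → (∀ {x y} → x ∈ xs → y ∈ xs → f x ≡ f y → x ≡ y) →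
             Unique xs → Unique (map f xs)
unique-map f []       inj []       = []
unique-map f (x ∷ xs) inj (x∉ ∷ u) =
  Allₚ.map⁺ (All.tabulate λ y∈ e → All.lookup x∉ y∈ (inj (here refl) (there y∈) e))
  ∷ unique-map f xs (λ p q → inj (there p) (there q)) u

allPairs-map : ∀ {A B : Set} {R : A → A → Set} {S : B → B → Set} (f : A → B) xs →
               (∀ {x y} → x ∈ xs → y ∈ xs → R x y → S (f x) (f y)) → AllPairs R xs → AllPairs S (map f xs)
allPairs-map f []       h []       = []
allPairs-map f (x ∷ xs) h (rs ∷ u) =
  Allₚ.map⁺ (All.tabulate λ y∈ → h (here refl) (there y∈) (All.lookup rs y∈))
  ∷ allPairs-map f xs (λ p q → h (there p) (there q)) u

module Dissect (n : ℕ) .{{nz : NonZero n}} where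
  open Cyclic n
  open Polygon n

  module _ (r : ℕ) (t₁ t₂ t₃ t₄ : Tree) (total : leaves* (t₁ ∷ t₂ ∷ t₃ ∷ t₄ ∷ []) ≡ n) where
    private
      module Q = Quadrilateral r t₁ t₂ t₃ t₄
      ts : Vec Tree 4
      ts = t₁ ∷ t₂ ∷ t₃ ∷ t₄ ∷ []

    end-window : ∀ {x y} → (x , y) ∈ chords* r ts → y ≤ n + r
    end-window p = ≤-trans (proj₂ (proj₂ (chords*-bounds r ts p))) (≤-reflexive (trans (cong (r +_) total) (+-comm r n)))

    -- Two listed intervals could share a chord only as complements `(r, d)` and `(d, n + r)`; the
    -- first would force `d ≤ p₁`, the second `p₃ ≤ d`.
    chord-injective : ∀ {p q} → p ∈ chords* r ts → q ∈ chords* r ts → chord p ≡ chord q → p ≡ q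
    chord-injective {c , d} {x , y} p q e =
      let r≤c , c<d , _ = chords*-bounds r ts p ; r≤x , x<y , _ = chords*-bounds r ts q in
      case p q (chord-window r r≤c (<⇒≤ c<d) (end-window p) r≤x (<⇒≤ x<y) (end-window q) e)
      where
      touching : ∀ {d} → (r , d) ∈ chords* r ts → (d , n + r) ∈ chords* r ts → ⊥
      touching p q = <⇒≱ Q.p₁<p₃ (≤-trans (Q.arc-end (Q.arc q) (Q.p₃<n+r total)) (Q.arc-start (Q.arc p) Q.r<p₁))
      case : ∀ {c d x y} → (c , d) ∈ chords* r ts → (x , y) ∈ chords* r ts → SameChord r c d x y → (c , d) ≡ (x , y)
      case p q same  = refl
      case p q wrapˡ = ⊥-elim (touching p q)
      case p q wrapʳ = ⊥-elim (touching q p)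

  polygon-unique : ∀ r (ts : Vec Tree 4) → leaves* ts ≡ n → Unique (polygon r ts)
  polygon-unique r ts@(t₁ ∷ t₂ ∷ t₃ ∷ t₄ ∷ []) total = unique-map chord (chords* r ts)
    (chord-injective r t₁ t₂ t₃ t₄ total) (AllPairs.map Laminar⇒≢ (chords*-laminar r ts))

  length-polygon : ∀ r (ts : Vec Tree 4) → leaves* ts ≡ n → length (polygon r ts) ≡ n ∸ 4
  length-polygon r ts total = trans (length-map chord (chords* r ts))
    (sym (trans (cong (_∸ 4) (trans (sym total) (sym (length-chords* r ts)))) (m+n∸m≡n 4 _)))

  module _ (t₁ t₂ t₃ t₄ : Tree) (total : leaves* (t₁ ∷ t₂ ∷ t₃ ∷ t₄ ∷ []) ≡ n) where
    private
      module Q = Quadrilateral 0 t₁ t₂ t₃ t₄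
      ts : Vec Tree 4
      ts = t₁ ∷ t₂ ∷ t₃ ∷ t₄ ∷ []

    -- An interval ending at `n` becomes a chord at vertex 0. It belongs to the fourth tree, and the
    -- three trees before it have at least one leaf each, whence `3 ≤ x`.
    data Normal (x y : ℕ) : Set where
      plain   : y < n → chord (x , y) ≡ (x , y) → Normal x y
      wrapped : y ≡ n → 3 ≤ x → chord (x , y) ≡ (0 , x) → Normal x y

    normal : ∀ {x y} → (x , y) ∈ chords* 0 ts → Normal x y
    normal {x} {y} p = [ (λ y<n → plain y<n (chord-< x<y y<n)) , wrap ]′ (m≤n⇒m<n∨m≡n y≤n)
      where
      bounds = chords*-bounds 0 ts p
      x<y : x < y
      x<y = <⇒≤ (proj₁ (proj₂ bounds))
      y≤n : y ≤ n
      y≤n = subst (y ≤_) total (proj₂ (proj₂ bounds))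
      wrap : y ≡ n → Normal x y
      wrap refl = wrapped refl 3≤x (trans (cong (λ z → chord (x , z)) (sym (+-identityʳ n)))
        (trans (chord-wrap x 0) (chord-< (≤-trans (s≤s z≤n) 3≤x) x<y)))
        where
        3≤p₃ : 3 ≤ Q.p₃
        3≤p₃ = +-mono-≤ (+-mono-≤ (leaves>0 t₁) (leaves>0 t₂)) (leaves>0 t₃)
        3≤x : 3 ≤ x
        3≤x = ≤-trans 3≤p₃ (Q.arc-end (Q.arc p) (subst (Q.p₃ <_) (+-identityʳ n) (Q.p₃<n+r total)))

    chord-diagonal : ∀ {p} → p ∈ chords* 0 ts → IsDiagonal n (chord p)
    chord-diagonal {x , y} p = case (normal p) (proj₁ (proj₂ (chords*-bounds 0 ts p)))
      where
      p₁+2≤n : 2 + Q.p₁ ≤ n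
      p₁+2≤n = ≤-trans (s≤s Q.p₁<p₂) (≤-trans Q.p₂<p₃ (<⇒≤ (subst (Q.p₃ <_) (+-identityʳ n) (Q.p₃<n+r total))))
      -- What has to be ruled out is the side `(0 , n - 1)`. A chord from 0 belongs to the first
      -- tree and ends by `p₁`, and two more corners lie strictly between `p₁` and `n`.
      short : ∀ x {y} → (x , y) ∈ chords* 0 ts → y < n → y ≤ x + (n ∸ 2)
      short zero    p _   = ≤-trans (Q.arc-start (Q.arc p) Q.r<p₁) (m+n≤o⇒n≤o∸m 2 p₁+2≤n)
        where
        m+n≤o⇒n≤o∸m : ∀ m {k o} → m + k ≤ o → k ≤ o ∸ m
        m+n≤o⇒n≤o∸m m {k} le = subst (_≤ _) (m+n∸m≡n m k) (∸-monoˡ-≤ m le)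
      short (suc x) {y} _ y<n = ≤-trans (≤-pred (≤-trans y<n (m≤n+m∸n n 2))) (s≤s (m≤n+m (n ∸ 2) x))
      case : Normal x y → 2 + x ≤ y → IsDiagonal n (chord (x , y))
      case (plain y<n e)        2+x≤y = subst (IsDiagonal n) (sym e) (y<n , 2+x≤y , short x p y<n)
      case (wrapped refl 3≤x e) 2+x≤n = subst (IsDiagonal n) (sym e)
        (<⇒≤ 2+x≤n , ≤-trans (n≤1+n 2) 3≤x , subst (_≤ n ∸ 2) (m+n∸m≡n 2 x) (∸-monoˡ-≤ 2 2+x≤n))

    chord-nonCrossing : ∀ {p q} → p ∈ chords* 0 ts → q ∈ chords* 0 ts → Laminar p q → NonCrossing (chord p) (chord q)
    chord-nonCrossing {x , y} {c , d} p q lam =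
      case (normal p) (normal q) lam (<⇒≤ (proj₁ (proj₂ (chords*-bounds 0 ts q))))
      where
      case : Normal x y → Normal c d → Laminar (x , y) (c , d) → c < d → NonCrossing (chord (x , y)) (chord (c , d))
      case (plain _ e) (plain _ e′) lam c<d = subst₂ NonCrossing (sym e) (sym e′) λ
        { (inj₁ (x<c , c<y , y<d)) → nc₁ lam c<y y<d
        ; (inj₂ (c<x , x<d , d<y)) → nc₂ lam c<x }
        where
        nc₁ : Laminar (x , y) (c , d) → c < y → y < d → ⊥
        nc₁ (under _ d≤y _) _   y<d = <⇒≱ y<d d≤y
        nc₁ (before _ y≤c)  c<y _   = <⇒≱ c<y y≤c
        nc₂ : Laminar (x , y) (c , d) → c < x → ⊥
        nc₂ (under x≤c _ _)  c<x = <⇒≱ c<x x≤c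
        nc₂ (before x<y y≤c) c<x = <⇒≱ (<-trans c<x x<y) y≤c
      case (wrapped refl _ e) (plain d<n e′) lam c<d = subst₂ NonCrossing (sym e) (sym e′) λ
        { (inj₁ (_ , c<x , _)) → nc lam c<x }
        where
        nc : Laminar (x , n) (c , d) → c < x → ⊥
        nc (under x≤c _ _) c<x = <⇒≱ c<x x≤c
        nc (before _ n≤c)  _   = <⇒≱ (<-trans c<d d<n) n≤c
      case (plain y<n e) (wrapped refl _ e′) lam c<d = subst₂ NonCrossing (sym e) (sym e′) λ
        { (inj₂ (_ , _ , c<y)) → nc lam c<y }
        where
        nc : Laminar (x , y) (c , n) → c < y → ⊥
        nc (under _ n≤y _) _   = <⇒≱ y<n n≤y
        nc (before _ y≤c)  c<y = <⇒≱ c<y y≤c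
      case (wrapped _ _ e) (wrapped _ _ e′) _ _ = subst₂ NonCrossing (sym e) (sym e′) λ { (inj₁ ()) ; (inj₂ ()) }

  dissection : (ts : Vec Tree 4) → leaves* ts ≡ n → Dissection n (n ∸ 4)
  dissection ts@(t₁ ∷ t₂ ∷ t₃ ∷ t₄ ∷ []) total = record
    { diags       = polygon 0 ts
    ; allDiag     = Allₚ.map⁺ (All.tabulate (chord-diagonal t₁ t₂ t₃ t₄ total))
    ; distinct    = polygon-unique 0 ts total
    ; size        = length-polygon 0 ts total
    ; nonCrossing = allPairs-map chord (chords* 0 ts) (chord-nonCrossing t₁ t₂ t₃ t₄ total) (chords*-laminar 0 ts)
    }

  polygon-rotate-~ : ∀ k r (ts : Vec Tree 4) → leaves* ts ≡ n →
    leaves* (iter k ts) ≡ n × ∃ λ r′ → polygon r ts ≃ polygon r′ (iter k ts)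
  polygon-rotate-~ zero    r ts total = total , r , (λ p → p) , (λ p → p)
  polygon-rotate-~ (suc k) r ts total =
    let total′ , r′ , eq = polygon-rotate-~ k r ts total in step (iter k ts) total′ r′ eq
    where
    step : ∀ us → leaves* us ≡ n → ∀ r′ → polygon r ts ≃ polygon r′ us →
           leaves* (rotate us) ≡ n × ∃ λ r″ → polygon r ts ≃ polygon r″ (rotate us)
    step (u ∷ us) total′ r′ eq = total-rotate u us total′ , r′ + leaves u ,
      ≃-trans eq (≃-sym (↭⇒≃ (polygon-rotate r′ u us total′)))

  -- The base point `r` walks from corner to corner towards `r′`. If it hits `r′`,
  -- `polygon-injective` applies; stepping over `r′` is what `no-offset` forbids. Every tree has a
  -- leaf, so each step advances and the fuel `k` suffices.
  polygon≃⇒~ : ∀ r r′ (ts us : Vec Tree 4) → leaves* ts ≡ n → leaves* us ≡ n →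
               r ≤ r′ → polygon r ts ≃ polygon r′ us → ts ~ us
  polygon≃⇒~ r r′ ts us T U r≤r′ = go (suc r′) r ts T r≤r′ (≤-trans (n<1+n r′) (m≤n+m (suc r′) r))
    where
    go : ∀ k r ts → leaves* ts ≡ n → r ≤ r′ → r′ < r + k → polygon r ts ≃ polygon r′ us → ts ~ us
    go zero r ts T r≤r′ r′<r eq = ⊥-elim (<⇒≱ r′<r (≤-trans (≤-reflexive (+-identityʳ r)) r≤r′))
    go (suc k) r ts@(t₁ ∷ t₂ ∷ t₃ ∷ t₄ ∷ []) T r≤r′ r′<r+k eq with r′ <? r + leaves t₁
    ... | yes r′<p₁ = [ (λ r<r′ → ⊥-elim (no-offset r r′ t₁ t₂ t₃ t₄ us T U eq r<r′ r′<p₁)) , aligned ]′ (m≤n⇒m<n∨m≡n r≤r′)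
      where
      aligned : r ≡ r′ → ts ~ us
      aligned refl = 0 , polygon-injective r ts us T U eq
    ... | no r′≮p₁ =
      let j , e = go k (r + leaves t₁) (rotate ts) (total-rotate t₁ (t₂ ∷ t₃ ∷ t₄ ∷ []) T) (≮⇒≥ r′≮p₁)
                    (<-≤-trans r′<r+k (≤-trans (≤-reflexive (+-suc r k)) (+-monoˡ-≤ k (a<a+leaves r t₁))))
                    (≃-trans (↭⇒≃ (polygon-rotate r t₁ (t₂ ∷ t₃ ∷ t₄ ∷ []) T)) eq)
      in j + 1 , trans (sym (iter-+ j 1 ts)) e

-- Every dissection comes from four trees

_≟ᵖ_ : DecidableEquality (ℕ × ℕ)
_≟ᵖ_ = ≡-dec _≟_ _≟_

length-partition : ∀ {A : Set} {P : A → Set} (P? : Decidable P) xs →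
                   length (filter P? xs) + length (filter (¬? ∘ P?) xs) ≡ length xs
length-partition P? []       = refl
length-partition P? (x ∷ xs) with P? x
... | yes _ = cong suc (length-partition P? xs)
... | no _  = trans (+-suc _ _) (cong suc (length-partition P? xs))

length-remove : ∀ {x} {xs : List (ℕ × ℕ)} → Unique xs → x ∈ xs →
                length xs ≡ suc (length (filter (λ y → ¬? (y ≟ᵖ x)) xs))
length-remove {x} {xs} u x∈ = Permₚ.↭-length (unique∧set⇒↭ u
  (All.tabulate (λ y∈ e → proj₂ (∈-filter⁻ other? {xs = xs} y∈) (sym e)) ∷ Uniqueₚ.filter⁺ other? u) to from)
  where
  other? = λ y → ¬? (y ≟ᵖ x)
  to : ∀ {y} → y ∈ xs → y ∈ x ∷ filter other? xs
  to {y} p with y ≟ᵖ x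
  ... | yes refl = here refl
  ... | no ne    = there (∈-filter⁺ other? p ne)
  from : ∀ {y} → y ∈ x ∷ filter other? xs → y ∈ xs
  from (here refl) = x∈
  from (there p)   = proj₁ (∈-filter⁻ other? p)

Cross-sym : ∀ p q → Cross p q → Cross q p
Cross-sym _ _ (inj₁ c) = inj₂ c
Cross-sym _ _ (inj₂ c) = inj₁ c

Cross-irrefl : ∀ p → ¬ Cross p p
Cross-irrefl _ (inj₁ (a<a , _)) = <-irrefl refl a<a
Cross-irrefl _ (inj₂ (a<a , _)) = <-irrefl refl a<a

nonCrossing-∈ : ∀ {xs} → AllPairs NonCrossing xs → ∀ {p q} → p ∈ xs → q ∈ xs → NonCrossing p q
nonCrossing-∈ (_ ∷ _)  (here refl) (here refl) = Cross-irrefl _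
nonCrossing-∈ (c ∷ _)  (here refl) (there q∈)  = All.lookup c q∈
nonCrossing-∈ (c ∷ _)  (there p∈)  (here refl) = All.lookup c p∈ ∘ Cross-sym _ _
nonCrossing-∈ (_ ∷ cs) (there p∈)  (there q∈)  = nonCrossing-∈ cs p∈ q∈

-- Locating the missing diagonal

record Region (a b : ℕ) (S : List (ℕ × ℕ)) : Set where
  field
    bounds : ∀ {x y} → (x , y) ∈ S → a ≤ x × 2 + x ≤ y × y ≤ b
    unique : Unique S
    planar : ∀ {p q} → p ∈ S → q ∈ S → NonCrossing p q

-- The farthest neighbour of `a`, with the path neighbour `suc a` as default. No chord can straddle
-- it, so it splits the region. Below a triangle on `(a, b)` it is the third vertex; if the
-- quadrilateral sits on `(a, b)`, it is the corner next to `a`, and the right half lacks its top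
-- chord.
record Apex (a b : ℕ) (O : List (ℕ × ℕ)) : Set where
  field
    apex  : ℕ
    a<    : a < apex
    <b    : apex < b
    which : apex ≡ suc a ⊎ (a , apex) ∈ O
    max   : ∀ {y} → (a , y) ∈ O → y ≤ apex

findApex : ∀ a b O → 2 + a ≤ b → (∀ {y} → (a , y) ∈ O → a < y × y < b) → Apex a b O
findApex a b [] 2+a≤b _ = record { apex = suc a ; a< = n<1+n a ; <b = 2+a≤b ; which = inj₁ refl ; max = λ () }
findApex a b ((x , y) ∷ O) 2+a≤b h with x ≟ a
... | no x≢a = record { A ; which = [ inj₁ , inj₂ ∘ there ]′ A.which
                      ; max = λ { (here refl) → ⊥-elim (x≢a refl) ; (there p) → A.max p } }
  where module A = Apex (findApex a b O 2+a≤b (h ∘ there))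
... | yes refl with y ≤? Apex.apex (findApex a b O 2+a≤b (h ∘ there))
...   | yes y≤ = record { A ; which = [ inj₁ , inj₂ ∘ there ]′ A.which
                        ; max = λ { (here refl) → y≤ ; (there p) → A.max p } }
  where module A = Apex (findApex a b O 2+a≤b (h ∘ there))
...   | no y≰ = record { apex = y ; a< = proj₁ (h (here refl)) ; <b = proj₂ (h (here refl)) ; which = inj₂ (here refl)
                       ; max = λ { (here refl) → ≤-refl ; (there p) → ≤-trans (A.max p) (<⇒≤ (≰⇒> y≰)) } }
  where module A = Apex (findApex a b O 2+a≤b (h ∘ there))

apex-splits : ∀ {a b O} → Region a b O → (A : Apex a b O) → ∀ {x y} → (x , y) ∈ O → y ≤ Apex.apex A ⊎ Apex.apex A ≤ x
apex-splits {a} R A {x} {y} p with y ≤? A.apex | A.apex ≤? x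
  where module A = Apex A
... | yes y≤c | _       = inj₁ y≤c
... | no _    | yes c≤x = inj₂ c≤x
... | no y≰c  | no c≰x with m≤n⇒m<n∨m≡n (proj₁ (Region.bounds R p))
...   | inj₂ refl = ⊥-elim (y≰c (Apex.max A p))
...   | inj₁ a<x  = ⊥-elim ([ (λ c≡ → <⇒≱ a<x (≤-pred (subst (x <_) c≡ (≰⇒> c≰x))))
                            , (λ q → Region.planar R q p (inj₁ (a<x , ≰⇒> c≰x , ≰⇒> y≰c))) ]′ (Apex.which A))

module Decode (n : ℕ) .{{nz : NonZero n}} (D : List (ℕ × ℕ)) where
  open Cyclic n
  open Polygon n

  Fit : ℕ → Tree → Set
  Fit a t = ∀ {p} → p ∈ chords a t → chord p ∈ D

  Full : ℕ → ℕ → Set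
  Full a b = Σ Tree λ t → (a + leaves t ≡ b) × Fit a t

  Pair : ℕ → ℕ → Set
  Pair a b = ∃ λ c → Full a c × Full c b

  Solution : Set
  Solution = Σ (Vec Tree 4) λ ts → ∃ λ r → (leaves* ts ≡ n) × (∀ {p} → p ∈ chords* r ts → chord p ∈ D)

  -- The quadrilateral lies in [a, b]; triangulating the complementary arc
  -- [b, n + a] yields the whole decomposition.
  Pending : ℕ → ℕ → Set
  Pending a b = Full b (n + a) → Solution

  full-leaf : ∀ a → Full a (suc a)
  full-leaf a = leaf , +-comm a 1 , λ ()

  full-node : ∀ {a c b} → Full a c → Full c b → chord (a , b) ∈ D → Full a b
  full-node {a} {b = b} (l , refl , fl) (r , refl , fr) ab∈ = node l r , sym (+-assoc a _ _) , fit
    where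
    fit : Fit a (node l r)
    fit (here refl) = subst (λ z → chord (a , z) ∈ D) (+-assoc a _ _) ab∈
    fit (there p)   = [ fl , fr ]′ (∈-++⁻ (chords a l) p)

  full-shift : ∀ {a b} → Full a b → Full (n + a) (n + b)
  full-shift {a} (t , refl , f) = t , +-assoc n a _ , fit
    where
    fit : Fit (n + a) t
    fit p with ∈-map⁻ (shift n) (subst (_ ∈_) (chords-shift n a t) p)
    ... | q , q∈ , refl = subst (_∈ D) (sym (chord-period₁ q)) (f q∈)

  solution : ∀ {a c₁ c₂ b} → Full a c₁ → Full c₁ c₂ → Full c₂ b → Pending a b
  solution {a} (t₁ , refl , f₁) (t₂ , refl , f₂) (t₃ , refl , f₃) (t₄ , e , f₄) =
    t₁ ∷ t₂ ∷ t₃ ∷ t₄ ∷ [] , a ,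
    +-cancelʳ-≡ a _ _ (trans (lem a (leaves t₁) (leaves t₂) (leaves t₃) (leaves t₄)) e) , fit
    where
    lem : ∀ a b c d e → b + (c + (d + (e + 0))) + a ≡ a + b + c + d + e
    lem = solve-∀
    fit : ∀ {p} → p ∈ chords* a (t₁ ∷ t₂ ∷ t₃ ∷ t₄ ∷ []) → chord p ∈ D
    fit p = [ f₁ , [ f₂ , [ f₃ , [ f₄ , (λ ()) ]′ ∘ ∈-++⁻ (chords _ t₄) ]′ ∘ ∈-++⁻ (chords _ t₃) ]′
              ∘ ∈-++⁻ (chords _ t₂) ]′ (∈-++⁻ (chords a t₁) p)

  -- The arc outside `[c, b]` is the arc outside `[a, b]` continued by `[a, c]` one period later,
  -- and its closing chord `(b, n + c)` is the chord `(c, b)` again.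
  pending-right : ∀ {a c b} → Full a c → chord (c , b) ∈ D → Pending c b → Pending a b
  pending-right {a} {c} {b} f cb∈ pend u =
    pend (full-node u (full-shift f) (subst (_∈ D) (sym (chord-wrap b c)) cb∈))

  pending-left : ∀ {a c b} → Full c b → chord (a , c) ∈ D → Pending a c → Pending a b
  pending-left {a} {c} {b} f ac∈ pend u = pend (full-node f u (subst (_∈ D) (sym (chord-wrap c a)) ac∈))

  -- The last argument is the number of diagonals missing from a full set.
  OpenResult : ℕ → ℕ → ℕ → Set
  OpenResult a b 0             = Pair a b
  OpenResult a b 1             = Pending a b
  OpenResult a b (suc (suc _)) = ⊤

  -- Here `(a, b)` itself counts among the required chords. If just one is missing, it is either
  -- `(a, b)`, leaving two full parts whose quadrilateral extends beyond the interval, or one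
  -- strictly below. Larger defects carry no data because the whole polygon has defect one.
  ClosedResult : ℕ → ℕ → ℕ → Set
  ClosedResult a b 0             = Full a b
  ClosedResult a b 1             = Pair a b ⊎ (chord (a , b) ∈ D × Pending a b)
  ClosedResult a b (suc (suc _)) = ⊤

  combine : ∀ {a c b} d e → ClosedResult a c d → ClosedResult c b e → OpenResult a b (d + e)
  combine 0 0 f g                               = _ , f , g
  -- The right half lacks its top chord, so its two parts together with the left half are three arcs
  -- of the quadrilateral.
  combine 0 1 f (inj₁ (_ , g , h))              = solution f g h
  combine 0 1 f (inj₂ (cb∈ , pend))             = pending-right f cb∈ pend
  combine 1 0 (inj₁ (_ , g , h)) f              = solution g h f
  combine 1 0 (inj₂ (ac∈ , pend)) f             = pending-left f ac∈ pend
  combine 0 (suc (suc _)) _ _                   = tt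
  combine 1 (suc _)       _ _                   = tt
  combine (suc (suc _)) _ _ _                   = tt

  close : ∀ {a b} d → chord (a , b) ∈ D → OpenResult a b d → ClosedResult a b d
  close 0             ab∈ (_ , f , g) = full-node f g ab∈
  close 1             ab∈ pend        = inj₂ (ab∈ , pend)
  close (suc (suc _)) _   _           = tt

  leave : ∀ {a b} d → OpenResult a b d → ClosedResult a b (suc d)
  leave 0       p = inj₁ p
  leave (suc _) _ = tt

  Decoded : List (ℕ × ℕ) → Set
  Decoded S = ∀ {p} → p ∈ S → chord p ∈ D

  -- `S` may contain `(a, b)`, while in `open′` it is absent. The full numbers of chords are
  -- `b - a - 1` and `b - a - 2`, and `d` is the shortfall. The fuel `k` bounds `b - a` and drops
  -- when the region is split at the apex.
  closed : ∀ k a b S → b ≤ k + a → a < b → Region a b S → Decoded S →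
           ∃ λ d → (suc (length S) + d + a ≡ b) × ClosedResult a b d
  open′ : ∀ k a b O → b ≤ k + a → 2 + a ≤ b → Region a b O → (a , b) ∉ O → Decoded O →
          ∃ λ d → (2 + length O + d + a ≡ b) × OpenResult a b d

  closed k a b S b≤ a<b R inD with m≤n⇒m<n∨m≡n a<b
  closed k a b [] b≤ a<b R inD | inj₂ refl = 0 , refl , full-leaf a
  closed k a b (_ ∷ _) b≤ a<b R inD | inj₂ refl =
    let a≤x , x<y , y≤b = Region.bounds R (here refl) in ⊥-elim (<⇒≱ x<y (≤-trans y≤b (s≤s a≤x)))
  ... | inj₁ 2+a≤b with mem? _≟ᵖ_ (a , b) S
  ...   | no ∉S = let d , e , res = open′ k a b S b≤ 2+a≤b R ∉S inD in
    suc d , trans (cong (λ z → suc (z + a)) (+-suc (length S) d)) e , leave d res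
  ...   | yes ∈S =
    let d , e , res = open′ k a b O b≤ 2+a≤b
          record { bounds = R.bounds ∘ proj₁ ∘ ∈O⁻ ; unique = Uniqueₚ.filter⁺ other? R.unique
                 ; planar = λ p q → R.planar (proj₁ (∈O⁻ p)) (proj₁ (∈O⁻ q)) }
          (λ p → proj₂ (∈O⁻ p) refl) (inD ∘ proj₁ ∘ ∈O⁻)
    in d , trans (cong (λ z → suc (z + d + a)) (length-remove R.unique ∈S)) e , close d (inD ∈S) res
    where
    module R = Region R
    other? = λ y → ¬? (y ≟ᵖ (a , b))
    O = filter other? S
    ∈O⁻ : ∀ {p} → p ∈ O → p ∈ S × p ≢ (a , b)
    ∈O⁻ = ∈-filter⁻ other?

  open′ zero a b O b≤ 2+a≤b = ⊥-elim (<⇒≱ (<⇒≤ 2+a≤b) b≤)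
  open′ (suc k) a b O b≤ 2+a≤b R ∉O inD =
    let d , e  , res  = closed k a A.apex L (≤-pred (≤-trans A.<b b≤)) A.a< regionˡ (inD ∘ proj₁ ∘ ∈L⁻)
        d′ , e′ , res′ = closed k A.apex b O′ (≤-trans b≤ (≤-trans (≤-reflexive (sym (+-suc k a))) (+-monoʳ-≤ k A.a<))) A.<b regionʳ (inD ∘ proj₁ ∘ ∈O′⁻)
    in d + d′ , slack e e′ , combine d d′ res res′
    where
    module R = Region R
    apex = findApex a b O 2+a≤b (λ p → let _ , 2+a≤y , y≤b = R.bounds p in
      <⇒≤ 2+a≤y , ≤∧≢⇒< y≤b λ { refl → ∉O p })
    module A = Apex apex
    under? : Decidable {A = ℕ × ℕ} (λ p → proj₂ p ≤ A.apex)
    under? p = proj₂ p ≤? A.apex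
    L  = filter under? O
    O′ = filter (¬? ∘ under?) O
    ∈L⁻ : ∀ {p} → p ∈ L → p ∈ O × proj₂ p ≤ A.apex
    ∈L⁻ = ∈-filter⁻ under?
    ∈O′⁻ : ∀ {p} → p ∈ O′ → p ∈ O × ¬ proj₂ p ≤ A.apex
    ∈O′⁻ = ∈-filter⁻ (¬? ∘ under?)
    regionˡ : Region a A.apex L
    regionˡ = record
      { bounds = λ p → let q , y≤ = ∈L⁻ p ; a≤x , x<y , _ = R.bounds q in a≤x , x<y , y≤
      ; unique = Uniqueₚ.filter⁺ under? R.unique
      ; planar = λ p q → R.planar (proj₁ (∈L⁻ p)) (proj₁ (∈L⁻ q)) }
    regionʳ : Region A.apex b O′
    regionʳ = record
      { bounds = λ p → let q , y≰ = ∈O′⁻ p ; _ , x<y , y≤b = R.bounds q in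
          [ ⊥-elim ∘ y≰ , (λ c≤x → c≤x) ]′ (apex-splits R apex q) , x<y , y≤b
      ; unique = Uniqueₚ.filter⁺ (¬? ∘ under?) R.unique
      ; planar = λ p q → R.planar (proj₁ (∈O′⁻ p)) (proj₁ (∈O′⁻ q)) }
    slack : ∀ {d d′} → suc (length L) + d + a ≡ A.apex → suc (length O′) + d′ + A.apex ≡ b →
          2 + length O + (d + d′) + a ≡ b
    slack {d} {d′} e e′ = trans (cong (λ z → 2 + z + (d + d′) + a) (sym (length-partition under? O)))
      (trans (lem (length L) (length O′) d d′ a) (trans (cong (suc (length O′) + d′ +_) e) e′))
      where
      lem : ∀ l m d d′ a → 2 + (l + m) + (d + d′) + a ≡ suc m + d′ + (suc l + d + a)
      lem = solve-∀

-- The polygon is cut open at the side `(0 , n - 1)`. Over `[0, n - 1]` a full set without that side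
-- has `n - 3` chords, so `n - 4` diagonals have defect exactly one.
decode : ∀ m (D : Dissection (4 + m) m) → Decode.Solution (4 + m) (diags D)
decode m D =
  let d , e , res = open′ (3 + m) 0 (3 + m) (diags D) (≤-reflexive (sym (+-identityʳ (3 + m)))) (s≤s (s≤s z≤n)) region notRoot inD
  -- The complementary arc `[n - 1, n]` is a single side, so the pending tree is a leaf.
  in subst (OpenResult 0 (3 + m)) (one d e) res (leaf , trans (+-comm (3 + m) 1) (sym (+-identityʳ (4 + m))) , λ ())
  where
  open Decode (4 + m) (diags D)
  open Cyclic (4 + m)
  diag : ∀ {p} → p ∈ diags D → IsDiagonal (4 + m) p
  diag = All.lookup (allDiag D)
  inD : Decoded (diags D)
  inD {x , y} p = let y<n , x<y , _ = diag p in subst (_∈ diags D) (sym (chord-< (<⇒≤ x<y) y<n)) p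
  notRoot : (0 , 3 + m) ∉ diags D
  notRoot p = let _ , _ , le = diag p in <-irrefl refl le
  region : Region 0 (3 + m) (diags D)
  region = record
    { bounds = λ p → let y<n , x<y , _ = diag p in z≤n , x<y , ≤-pred y<n
    ; unique = distinct D
    ; planar = nonCrossing-∈ (nonCrossing D) }
  one : ∀ d → 2 + length (diags D) + d + 0 ≡ 3 + m → d ≡ 1
  one d e = +-cancelˡ-≡ (2 + m) d 1 (trans (cong (λ z → 2 + z + d) (sym (size D)))
    (trans (sym (+-identityʳ _)) (trans e (cong (λ z → suc (suc z)) (+-comm 1 m)))))

-- Counting orbits

map-cong-∈ : ∀ {A B : Set} {f g : A → B} xs → (∀ {x} → x ∈ xs → f x ≡ g x) → map f xs ≡ map g xs
map-cong-∈ []       h = refl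
map-cong-∈ (x ∷ xs) h = cong₂ _∷_ (h (here refl)) (map-cong-∈ xs (h ∘ there))

map-≃ : ∀ {A B : Set} (f : A → B) {xs ys} → xs ≃ ys → map f xs ≃ map f ys
map-≃ f {xs} {ys} (g , h) = go g , go h
  where
  go : ∀ {as bs} → (∀ {x} → x ∈ as → x ∈ bs) → ∀ {z} → z ∈ map f as → z ∈ map f bs
  go k z∈ with ∈-map⁻ f z∈
  ... | _ , x∈ , refl = ∈-map⁺ f (k x∈)

⊆-length⇒⊇ : ∀ {xs ys : List (ℕ × ℕ)} → Unique xs → Unique ys → length xs ≡ length ys →
              (∀ {x} → x ∈ xs → x ∈ ys) → ∀ {y} → y ∈ ys → y ∈ xs
⊆-length⇒⊇ {xs} {ys} u v len sub {y} y∈ =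
  proj₂ (∈-filter⁻ in? {xs = ys} (subst (y ∈_) (sym (filter-complete in? (trans (sym (Permₚ.↭-length perm)) len))) y∈))
  where
  in? = λ y → mem? _≟ᵖ_ y xs
  perm = unique∧set⇒↭ u (Uniqueₚ.filter⁺ in? v) (λ p → ∈-filter⁺ in? (sub p) p) (λ p → proj₂ (∈-filter⁻ in? {xs = ys} p))

separate-injective : ∀ {xs} → AllPairs (λ x y → ¬ x ~ y) xs → ∀ i j → lookup xs i ~ lookup xs j → i ≡ j
separate-injective (_ ∷ _)  zero    zero    _ = refl
separate-injective (h ∷ _)  zero    (suc j) e = ⊥-elim (All.lookup h (∈-lookup j) e)
separate-injective (h ∷ _)  (suc i) zero    e = ⊥-elim (All.lookup h (∈-lookup i) (~-sym e))
separate-injective (_ ∷ hs) (suc i) (suc j) e = cong suc (separate-injective hs i j e)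

module Orbits (n : ℕ) .{{nz : NonZero n}} where
  open Cyclic n
  open Polygon n
  open Dissect n

  -- An interval of length `n` would have both ends at one vertex, where `rot-chord` fails. An
  -- interval ending at `n + r` belongs to the fourth tree and hence starts after `r`.
  chord-short : ∀ r (ts : Vec Tree 4) → leaves* ts ≡ n → ∀ {x y} → (x , y) ∈ chords* r ts → y < n + x
  chord-short r ts@(t₁ ∷ t₂ ∷ t₃ ∷ t₄ ∷ []) total {x} {y} p =
    [ (λ y<n+r → <-≤-trans y<n+r (+-monoʳ-≤ n (proj₁ (chords*-bounds r ts p)))) , atEnd ]′
      (m≤n⇒m<n∨m≡n (end-window r t₁ t₂ t₃ t₄ total p))
    where
    module Q = Quadrilateral r t₁ t₂ t₃ t₄
    atEnd : y ≡ n + r → y < n + x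
    atEnd refl = +-monoʳ-< n (<-≤-trans (<-trans Q.r<p₁ Q.p₁<p₃) (Q.arc-end (Q.arc p) (Q.p₃<n+r total)))

  rot-polygon : ∀ k r (ts : Vec Tree 4) → leaves* ts ≡ n → map (rot n k) (polygon r ts) ≡ polygon (k + r) ts
  rot-polygon k r ts total = begin
    map (rot n k) (map chord (chords* r ts))     ≡⟨ map-∘ (chords* r ts) ⟨
    map (rot n k ∘ chord) (chords* r ts)         ≡⟨ map-cong-∈ (chords* r ts) turn ⟩
    map (chord ∘ shift k) (chords* r ts)         ≡⟨ map-∘ (chords* r ts) ⟩
    map chord (map (shift k) (chords* r ts))     ≡⟨ cong (map chord) (chords*-shift k r ts) ⟨
    map chord (chords* (k + r) ts)               ∎
    where
    turn : ∀ {p} → p ∈ chords* r ts → rot n k (chord p) ≡ chord (shift k p)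
    turn {x , y} p = rot-chord k (<⇒≤ (proj₁ (proj₂ (chords*-bounds r ts p)))) (chord-short r ts total p)

  polygon-period : ∀ {s} q (ts : Vec Tree s) → polygon (q * n) ts ≡ polygon 0 ts
  polygon-period q ts = begin
    map chord (chords* (q * n) ts)                    ≡⟨ cong (λ z → map chord (chords* z ts)) (+-identityʳ (q * n)) ⟨
    map chord (chords* (q * n + 0) ts)                ≡⟨ cong (map chord) (chords*-shift (q * n) 0 ts) ⟩
    map chord (map (shift (q * n)) (chords* 0 ts))    ≡⟨ map-∘ (chords* 0 ts) ⟨
    map (chord ∘ shift (q * n)) (chords* 0 ts)        ≡⟨ map-cong (chord-period q) (chords* 0 ts) ⟩
    map chord (chords* 0 ts)                          ∎

  -- The rotation that brings the base point `r` back to vertex 0. Its index must stay below `n`, so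
  -- residue zero needs its own case.
  complement : ∀ r → ∃ λ (k : Fin n) → ∃ λ q → toℕ k + r ≡ q * n
  complement r with r % n in eq
  ... | zero  = fromℕ< 0<n , r / n , trans (cong (_+ r) (toℕ-fromℕ< 0<n)) (trans (m≡m%n+[m/n]*n r n) (cong (_+ r / n * n) eq))
    where
    0<n : 0 < n
    0<n = ≤-<-trans z≤n (m%n<n r n)
  ... | suc p = fromℕ< k<n , suc (r / n) , (begin
    toℕ (fromℕ< k<n) + r                   ≡⟨ cong₂ _+_ (toℕ-fromℕ< k<n) (m≡m%n+[m/n]*n r n) ⟩
    (n ∸ suc p) + (r % n + r / n * n)      ≡⟨ cong (λ z → (n ∸ suc p) + (z + r / n * n)) eq ⟩
    (n ∸ suc p) + (suc p + r / n * n)      ≡⟨ +-assoc (n ∸ suc p) (suc p) _ ⟨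
    (n ∸ suc p) + suc p + r / n * n        ≡⟨ cong (_+ r / n * n) (m∸n+n≡m p<n) ⟩
    n + r / n * n                          ∎)
    where
    p<n : suc p ≤ n
    p<n = <⇒≤ (subst (_< n) eq (m%n<n r n))
    k<n : n ∸ suc p < n
    k<n = ∸-monoʳ-< (s≤s z≤n) p<n

  ≃⇒≈Rot : ∀ (D : Dissection n (n ∸ 4)) r (ts : Vec Tree 4) (total : leaves* ts ≡ n) →
            diags D ≃ polygon r ts → D ≈Rot dissection ts total
  ≃⇒≈Rot D r ts@(_ ∷ _ ∷ _ ∷ _ ∷ []) total eq =
    let k , q , e = complement r
        f , g = subst (map (rot n (toℕ k)) (diags D) ≃_)
          (trans (rot-polygon (toℕ k) r ts total) (trans (cong (λ z → polygon z ts) e) (polygon-period q ts)))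
          (map-≃ (rot n (toℕ k)) eq)
    in k , λ x → mk⇔ f g

  ≈Rot⇒~ : ∀ (ts us : Vec Tree 4) (T : leaves* ts ≡ n) (U : leaves* us ≡ n) →
            dissection ts T ≈Rot dissection us U → ts ~ us
  ≈Rot⇒~ ts@(_ ∷ _ ∷ _ ∷ _ ∷ []) us@(_ ∷ _ ∷ _ ∷ _ ∷ []) T U (k , eq) =
    -- `polygon≃⇒~` walks from the smaller base point. The rotation moves `ts`, so the walk starts
    -- with `us` at 0 and the result is reversed.
    ~-sym (polygon≃⇒~ 0 (toℕ k + 0) us ts U T z≤n
      (subst (polygon 0 us ≃_) (rot-polygon (toℕ k) 0 ts T)
        ((λ {x} → Equivalence.from (eq x)) , (λ {x} → Equivalence.to (eq x)))))

-- Quadruples fixed by a rotation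

module Fixed {s} (m d : ℕ) (copies : Vec Tree s → Vec Tree 4)
             (copies-injective : ∀ {us vs} → copies us ≡ copies vs → us ≡ vs)
             (leaves*-copies : ∀ us → leaves* (copies us) ≡ leaves* us * d)
             {P : Vec Tree 4 → Set} (P? : Decidable P)
             (P-copies : ∀ us → P (copies us)) (copies-P : ∀ ts → P ts → ∃ λ us → ts ≡ copies us) where

  fixed-count : ∀ k .{{_ : NonZero d}} → (k + s) * d ≡ m + 4 → length (filter P? (forests m 4)) ≡ #forests k s
  fixed-count k e = trans
    (Permₚ.↭-length (unique∧set⇒↭ (Uniqueₚ.filter⁺ P? (forests-unique m 4))
      (Uniqueₚ.map⁺ copies-injective (forests-unique k s)) to from))
    (length-map copies (forests k s))
    where
    to : ∀ {ts} → ts ∈ filter P? (forests m 4) → ts ∈ map copies (forests k s)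
    to p with ∈-filter⁻ P? {xs = forests m 4} p
    ... | ts∈ , pts with copies-P _ pts
    ...   | us , refl = ∈-map⁺ copies (∈-forests⁺ k s us
      (*-cancelʳ-≡ (leaves* us) (k + s) d (trans (sym (leaves*-copies us)) (trans (∈-forests⁻ m 4 ts∈) (sym e)))))
    from : ∀ {ts} → ts ∈ map copies (forests k s) → ts ∈ filter P? (forests m 4)
    from p with ∈-map⁻ copies p
    ... | us , us∈ , refl = ∈-filter⁺ P?
      (∈-forests⁺ m 4 (copies us) (trans (leaves*-copies us) (trans (cong (_* d) (∈-forests⁻ k s us∈)) e))) (P-copies us)

  fixed-none : ¬ d ∣ m + 4 → length (filter P? (forests m 4)) ≡ 0
  fixed-none d∤ = cong length (filter-none P? (All.tabulate λ {ts} ts∈ pts → absurd ts∈ (copies-P ts pts)))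
    where
    absurd : ∀ {ts} → ts ∈ forests m 4 → (∃ λ us → ts ≡ copies us) → ⊥
    absurd ts∈ (us , refl) = d∤ (divides (leaves* us) (trans (sym (∈-forests⁻ m 4 ts∈)) (leaves*-copies us)))

fourfold : Vec Tree 1 → Vec Tree 4
fourfold (u ∷ []) = u ∷ u ∷ u ∷ u ∷ []

twofold : Vec Tree 2 → Vec Tree 4
twofold (u ∷ v ∷ []) = u ∷ v ∷ u ∷ v ∷ []

rotate-fixed : ∀ ts → rotate ts ≡ ts → ∃ λ us → ts ≡ fourfold us
rotate-fixed (t ∷ _ ∷ _ ∷ _ ∷ []) refl = t ∷ [] , refl

rotate²-fixed : ∀ ts → rotate (rotate ts) ≡ ts → ∃ λ us → ts ≡ twofold us
rotate²-fixed (t ∷ u ∷ _ ∷ _ ∷ []) refl = t ∷ u ∷ [] , refl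

leaves*-fourfold : ∀ us → leaves* (fourfold us) ≡ leaves* us * 4
leaves*-fourfold (u ∷ []) = lem (leaves u)
  where
  lem : ∀ a → a + (a + (a + (a + 0))) ≡ (a + 0) * 4
  lem = solve-∀

leaves*-twofold : ∀ us → leaves* (twofold us) ≡ leaves* us * 2
leaves*-twofold (u ∷ v ∷ []) = lem (leaves u) (leaves v)
  where
  lem : ∀ a b → a + (b + (a + (b + 0))) ≡ (a + (b + 0)) * 2
  lem = solve-∀

fourfold-injective : ∀ {us vs} → fourfold us ≡ fourfold vs → us ≡ vs
fourfold-injective {_ ∷ []} {_ ∷ []} refl = refl

twofold-injective : ∀ {us vs} → twofold us ≡ twofold vs → us ≡ vs
twofold-injective {_ ∷ _ ∷ []} {_ ∷ _ ∷ []} refl = refl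

rotate-fourfold : ∀ us → rotate (fourfold us) ≡ fourfold us
rotate-fourfold (_ ∷ []) = refl

rotate²-twofold : ∀ us → rotate (rotate (twofold us)) ≡ twofold us
rotate²-twofold (_ ∷ _ ∷ []) = refl

module Fourfold (m : ℕ) = Fixed m 4 fourfold fourfold-injective leaves*-fourfold
  (λ ts → rotate ts ≟* ts) rotate-fourfold rotate-fixed

module Twofold (m : ℕ) = Fixed m 2 twofold twofold-injective leaves*-twofold
  (λ ts → rotate (rotate ts) ≟* ts) rotate²-twofold rotate²-fixed

#rotate-fixed : ∀ m → length (filter (λ ts → rotate ts ≟* ts) (forests m 4)) ≡ CatFrac (m + 4) 4
#rotate-fixed m with 4 ∣? m + 4
... | no 4∤ = trans (Fourfold.fixed-none m 4∤) (sym (CatFrac-∤ (m + 4) 4 4∤))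
... | yes (divides zero e) = ⊥-elim (m+1+n≢0 m e)
... | yes (divides (suc p) e) = begin
  length (filter (λ ts → rotate ts ≟* ts) (forests m 4))
                         ≡⟨ Fourfold.fixed-count m p (trans (cong (_* 4) (+-comm p 1)) (sym e)) ⟩
  #forests p 1           ≡⟨ #trees≡Cat p ⟩
  Cat p                  ≡⟨ CatFrac-multiple p 4 ⟨
  CatFrac (suc p * 4) 4  ≡⟨ cong (λ z → CatFrac z 4) e ⟨
  CatFrac (m + 4) 4      ∎

#rotate²-fixed : ∀ m → length (filter (λ ts → rotate (rotate ts) ≟* ts) (forests m 4)) ≡ CatFrac (m + 4) 2
#rotate²-fixed m with 2 ∣? m + 4
... | no 2∤ = trans (Twofold.fixed-none m 2∤) (sym (CatFrac-∤ (m + 4) 2 2∤))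
... | yes (divides zero e) = ⊥-elim (m+1+n≢0 m e)
-- Quotient 1 would mean a 2-gon. From quotient `2 + p` on, the repeated pair has `2 + p` leaves,
-- hence `p` internal nodes.
... | yes (divides (suc zero) e) = ⊥-elim (m+1+n≢0 m (+-cancelʳ-≡ 2 (m + 2) 0 (trans (+-assoc m 2 2) e)))
... | yes (divides (suc (suc p)) e) = begin
  length (filter (λ ts → rotate (rotate ts) ≟* ts) (forests m 4))
                               ≡⟨ Twofold.fixed-count m p (trans (cong (_* 2) (+-comm p 2)) (sym e)) ⟩
  #forests p 2                 ≡⟨ #pairs≡Cat p ⟩
  Cat (suc p)                  ≡⟨ CatFrac-multiple (suc p) 2 ⟨
  CatFrac (suc (suc p) * 2) 2  ≡⟨ cong (λ z → CatFrac z 2) e ⟨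
  CatFrac (m + 4) 2            ∎

-- Orbit representatives and the final count

module Count (m : ℕ) where
  open Orbits (4 + m)
  open Cyclic (4 + m)
  open Polygon (4 + m)
  open Dissect (4 + m)

  rotate-closed : ∀ {ts} → ts ∈ forests m 4 → rotate ts ∈ forests m 4
  rotate-closed {ts} p = ∈-forests⁺ m 4 (rotate ts) (trans (leaves*-rotate ts) (∈-forests⁻ m 4 p))

  module R = Transversal (transversal (forests m 4) (forests-unique m 4) rotate-closed)

  total : ∀ {ts} → ts ∈ R.reps → leaves* ts ≡ 4 + m
  total p = trans (∈-forests⁻ m 4 (R.⊆L p)) (+-comm m 4)

  rep : Fin (length R.reps) → Dissection (4 + m) m
  rep i = dissection (lookup R.reps i) (total (∈-lookup i))

  -- Decoding only guarantees that the chords of the trees occur in `D`. Both lists are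
  -- duplicate-free of the same length, so nothing else does.
  polygon≃diags : ∀ (D : Dissection (4 + m) m) r ts → leaves* ts ≡ 4 + m →
                  (∀ {p} → p ∈ chords* r ts → chord p ∈ diags D) → diags D ≃ polygon r ts
  polygon≃diags D r ts T fit =
    ⊆-length⇒⊇ (polygon-unique r ts T) (distinct D) (trans (length-polygon r ts T) (sym (size D))) sub , sub
    where
    sub : ∀ {z} → z ∈ polygon r ts → z ∈ diags D
    sub z∈ with ∈-map⁻ chord z∈
    ... | _ , p∈ , refl = fit p∈

  rep-cover : ∀ D → ∃ λ i → D ≈Rot rep i
  rep-cover D = cover (decode m D)
    where
    at : ∀ {y} (y∈ : y ∈ R.reps) r → diags D ≃ polygon r y → ∃ λ i → D ≈Rot rep i
    at y∈ r eq = index y∈ , ≃⇒≈Rot D r (lookup R.reps (index y∈)) (total (∈-lookup (index y∈)))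
      (subst (λ z → diags D ≃ polygon r z) (lookup-index y∈) eq)

    cover : Decode.Solution (4 + m) (diags D) → ∃ λ i → D ≈Rot rep i
    cover (ts , r , T , fit) with R.cover (∈-forests⁺ m 4 ts (trans T (+-comm 4 m)))
    ... | y , y∈ , k , refl =
      let _ , r′ , eq = polygon-rotate-~ k r ts T
      in at y∈ r′ (≃-trans (polygon≃diags D r ts T fit) eq)

  rep-separate : ∀ i j → rep i ≈Rot rep j → i ≡ j
  rep-separate i j e = separate-injective R.separate i j
    (≈Rot⇒~ (lookup R.reps i) (lookup R.reps j) (total (∈-lookup i)) (total (∈-lookup j)) e)

  count : 4 * (4 + m) * length R.reps ≡
          2 * suc m * Cat (2 + m) + 2 * (4 + m) * CatFrac (4 + m) 4 + (4 + m) * CatFrac (4 + m) 2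
  count = begin
    4 * n * length R.reps
      ≡⟨ lem₁ n (length R.reps) ⟩
    n * (4 * length R.reps)
      ≡⟨ cong (n *_) (trans R.count (weights-count (forests m 4))) ⟩
    n * (#forests m 4 + length (filter (λ ts → rotate (rotate ts) ≟* ts) (forests m 4))
          + 2 * length (filter (λ ts → rotate ts ≟* ts) (forests m 4)))
      ≡⟨ cong₂ (λ a b → n * (#forests m 4 + a + 2 * b))
           (trans (#rotate²-fixed m) (cong (λ z → CatFrac z 2) (+-comm m 4)))
           (trans (#rotate-fixed m) (cong (λ z → CatFrac z 4) (+-comm m 4))) ⟩
    n * (#forests m 4 + CatFrac n 2 + 2 * CatFrac n 4)
      ≡⟨ lem₂ n (#forests m 4) (CatFrac n 2) (CatFrac n 4) ⟩
    n * #forests m 4 + 2 * n * CatFrac n 4 + n * CatFrac n 2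
      ≡⟨ cong (λ z → z + 2 * n * CatFrac n 4 + n * CatFrac n 2) (#quadruples m) ⟩
    2 * suc m * Cat (2 + m) + 2 * n * CatFrac n 4 + n * CatFrac n 2 ∎
    where
    n = 4 + m
    lem₁ : ∀ n k → 4 * n * k ≡ n * (4 * k)
    lem₁ = solve-∀
    lem₂ : ∀ n q b a → n * (q + b + 2 * a) ≡ n * q + 2 * n * a + n * b
    lem₂ = solve-∀

theorem2 : (n : ℕ) → 4 ≤ n →
    Σ ℕ (λ N → OrbitCount n (n ∸ 4) N ×
    (4 * n * N ≡ 2 * (n ∸ 3) * Cat (n ∸ 2) + 2 * n * CatFrac n 4 + n * CatFrac n 2))
theorem2 (suc (suc (suc (suc m)))) (s≤s (s≤s (s≤s (s≤s _)))) =
  length R.reps , (rep , rep-cover , rep-separate) , count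
  where open Count m
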